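{- Let $n\ge 3$ be odd and let $SD_{8n}=\langle a,b : a^{4n}=e,\ b^2=e,\ ba=a^{2n-1}b\rangle$. Then the characteristic polynomial of the Laplacian matrix of $CSCom(SD_{8n})$ is \[\Phi(L(CSCom(SD_{8n})),x)=x(x-4)(x-4n)^{4n-5}(x-(4n+4))^{4n-1}(x-8n)^4.\]
   Context: For a finite group $G$ and $x\in G$, $[x]$ denotes the conjugacy class of $x$. The conjugacy supercommuting graph $CSCom(G)$ is the simple graph with vertex set $G$ in which two distinct vertices $x,y$ are adjacent iff there exist $x'\in[x]$, $y'\in[y]$ with $x'y'=y'x'$ ($x'=y'$ permitted). The Laplacian matrix is $L=D-A$; $\Phi(L,x)=\det(xI-L)$. -}

module Defs where

open import Data.Nat as ℕ using (ℕ; zero; suc; _∸_)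
open import Data.Nat.DivMod using (_mod_)
open import Data.Fin using (Fin; zero; suc; toℕ; punchIn; remQuot; _≟_)
open import Data.Integer as ℤ using (ℤ; +_; -_; _+_; _-_; _*_)
open import Data.Product using (_×_; _,_; ∃-syntax)
open import Data.Sum using (_⊎_)
open import Data.Bool using (if_then_else_)
open import Relation.Nullary using (¬_)
open import Relation.Nullary.Decidable using (⌊_⌋)
open import Relation.Binary.PropositionalEquality using (_≡_; _≢_)

-- The semidihedral group SD_{8n} = ⟨ a, b ∣ a^{4n} = b^2 = e, ba = a^{2n-1} b ⟩.
-- The element (i , j) : Fin (4n) × Fin 2 stands for a^i b^j (normal form).

SD : ℕ → Set
SD n = Fin (4 ℕ.* n) × Fin 2

-- (a^i b^j)(a^k b^l) = a^{i + (2n-1)^j k} b^{j+l}, since b a^k = a^{(2n-1)k} b.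
SD-mul : (n : ℕ) → SD n → SD n → SD n
SD-mul zero (() , _) _
SD-mul (suc m) (i , j) (k , l) =
  ((toℕ i ℕ.+ twist j (toℕ k)) mod (4 ℕ.* suc m) , (toℕ j ℕ.+ toℕ l) mod 2)
  where
  twist : Fin 2 → ℕ → ℕ
  twist zero k = k
  twist (suc _) k = (2 ℕ.* suc m ∸ 1) ℕ.* k

-- x' ∈ [x]  iff  x' = g x g⁻¹ for some g, i.e. g x = x' g.
InConjClass : (n : ℕ) → SD n → SD n → Set
InConjClass n x x' = ∃[ g ] SD-mul n g x ≡ SD-mul n x' g

CSComAdj : (n : ℕ) → SD n → SD n → Set
CSComAdj n x y =
  x ≢ y × ∃[ x' ] ∃[ y' ]
    (InConjClass n x x' × InConjClass n y y' × SD-mul n x' y' ≡ SD-mul n y' x')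

Vtx : ℕ → Set
Vtx n = Fin (4 ℕ.* n ℕ.* 2)

elt : (n : ℕ) → Vtx n → SD n
elt n v = remQuot {4 ℕ.* n} 2 v

IsAdjMatrix : (n : ℕ) → (Vtx n → Vtx n → ℤ) → Set
IsAdjMatrix n A = ∀ u v →
  (CSComAdj n (elt n u) (elt n v) × A u v ≡ + 1)
  ⊎ (¬ CSComAdj n (elt n u) (elt n v) × A u v ≡ + 0)

Σℤ : ∀ {k} → (Fin k → ℤ) → ℤ
Σℤ {zero} f = + 0
Σℤ {suc k} f = f zero + Σℤ (λ i → f (suc i))

sgn : ℕ → ℤ
sgn zero = + 1
sgn (suc k) = - sgn k

det : ∀ {k} → (Fin k → Fin k → ℤ) → ℤ
det {zero} M = + 1
det {suc k} M =
  Σℤ (λ j → sgn (toℕ j) * M zero j * det (λ r c → M (suc r) (punchIn j c)))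

δ : ∀ {k} → Fin k → Fin k → ℤ
δ u v = if ⌊ u ≟ v ⌋ then + 1 else + 0

laplacian : ∀ {k} → (Fin k → Fin k → ℤ) → Fin k → Fin k → ℤ
laplacian A u v = δ u v * Σℤ (A u) - A u v

charPolyAt : ∀ {k} → (Fin k → Fin k → ℤ) → ℤ → ℤ
charPolyAt M x = det (λ u v → x * δ u v - M u v)

-- For odd n the centre of SD_8n is {a^kn}, and CSCom(SD_8n) is the complete graph with all edges
-- between non-central rotations and reflections removed: rotations commute with each other, central
-- elements with everything, any two reflections have commuting conjugates, while every conjugate of
-- a non-central rotation is again one and commutes with no reflection. So in xI − L the degree of a
-- vertex and the adjacency of two distinct vertices depend only on their kinds (central, reflection,
-- non-central rotation). Subtracting from a row the row of another vertex of the same kind and adding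
-- the corresponding column leaves the single entry x − deg in that row; expanding along such rows
-- removes all but one vertex of each kind, and the remaining 3 × 3 quotient matrix has determinant
-- x(x − 4)(x − 8n).
module Submission where

open import Defs
open import Function using (_∘_)
open import Data.Nat as ℕ using (ℕ; zero; suc; _≤_; _∸_; _%_)
import Data.Nat.Properties as ℕP
open import Data.Fin using (Fin; zero; suc; toℕ; punchIn; punchOut; inject₁; _≟_; _↑ˡ_; _↑ʳ_; combine; remQuot)
open import Data.Fin.Patterns using (0F; 1F; 2F)
import Data.Fin.Properties as FinP
open import Data.Product using (_×_; _,_; proj₁; proj₂; uncurry; ∃-syntax)
open import Data.Sum using (_⊎_; inj₁; inj₂)
open import Data.Empty using (⊥; ⊥-elim)
open import Relation.Nullary using (¬_; Dec; yes; no; contradiction)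
open import Relation.Binary.PropositionalEquality

data Kind : Set where
  central reflection rotation : Kind

data Unlinked : Kind → Kind → Set where
  rotation-reflection : Unlinked rotation reflection
  reflection-rotation : Unlinked reflection rotation

unlinked? : ∀ T T′ → Dec (Unlinked T T′)
unlinked? central _ = no (λ ())
unlinked? reflection central = no (λ ())
unlinked? reflection reflection = no (λ ())
unlinked? reflection rotation = yes reflection-rotation
unlinked? rotation central = no (λ ())
unlinked? rotation reflection = yes rotation-reflection
unlinked? rotation rotation = no (λ ())

Unlinked-cases : ∀ {T T′} → Unlinked T T′ → (T ≡ rotation × T′ ≡ reflection) ⊎ (T ≡ reflection × T′ ≡ rotation)
Unlinked-cases rotation-reflection = inj₁ (refl , refl)
Unlinked-cases reflection-rotation = inj₂ (refl , refl)

Unlinked-irreflexive : ∀ {T} → Unlinked T T → ⊥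
Unlinked-irreflexive ()

-- Congruences modulo N

module ModularArithmetic (N : ℕ) .{{_ : ℕ.NonZero N}} where

  open import Level using (0ℓ)
  open import Data.Nat using (_+_; _*_; _/_)
  open import Data.Nat.DivMod
  open import Data.Nat.Divisibility
  open import Relation.Binary.Bundles using (Setoid)

  infix 4 _≈_
  record _≈_ (a b : ℕ) : Set where
    constructor mk
    field residue : a % N ≡ b % N

  ≈-setoid : Setoid 0ℓ 0ℓ
  ≈-setoid = record
    { Carrier = ℕ
    ; _≈_ = _≈_
    ; isEquivalence = record
      { refl = mk refl
      ; sym = λ (mk p) → mk (sym p)
      ; trans = λ (mk p) (mk q) → mk (trans p q)
      }
    }

  open Setoid ≈-setoid public using () renaming (refl to ≈-refl; sym to ≈-sym; trans to ≈-trans)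

  ≡⇒≈ : ∀ {a b} → a ≡ b → a ≈ b
  ≡⇒≈ refl = ≈-refl

  %-≈ : ∀ a → a % N ≈ a
  %-≈ a = mk (m%n%n≡m%n a N)

  +-≈ : ∀ {a a′ b b′} → a ≈ a′ → b ≈ b′ → a + b ≈ a′ + b′
  +-≈ {a} {a′} {b} {b′} (mk p) (mk q) =
    mk (trans (%-distribˡ-+ a b N) (trans (cong₂ (λ x y → (x + y) % N) p q) (sym (%-distribˡ-+ a′ b′ N))))

  *-≈ : ∀ c {a a′} → a ≈ a′ → c * a ≈ c * a′
  *-≈ c {a} {a′} (mk p) =
    mk (trans (%-distribˡ-* c a N) (trans (cong (λ x → (c % N * x) % N) p) (sym (%-distribˡ-* c a′ N))))

  +-multiple-≈ : ∀ a k → a + k * N ≈ a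
  +-multiple-≈ a k = mk ([m+kn]%n≡m%n a k N)

  ≈⇒quotients : ∀ {a b} → a ≈ b → a + (b / N) * N ≡ b + (a / N) * N
  ≈⇒quotients {a} {b} (mk p) = begin
    a + (b / N) * N                   ≡⟨ cong (_+ (b / N) * N) (m≡m%n+[m/n]*n a N) ⟩
    a % N + (a / N) * N + (b / N) * N ≡⟨ cong (λ x → x + (a / N) * N + (b / N) * N) p ⟩
    b % N + (a / N) * N + (b / N) * N ≡⟨ ℕP.+-assoc (b % N) _ _ ⟩
    b % N + ((a / N) * N + (b / N) * N) ≡⟨ cong (b % N +_) (ℕP.+-comm ((a / N) * N) _) ⟩
    b % N + ((b / N) * N + (a / N) * N) ≡⟨ ℕP.+-assoc (b % N) _ _ ⟨
    b % N + (b / N) * N + (a / N) * N ≡⟨ cong (_+ (a / N) * N) (m≡m%n+[m/n]*n b N) ⟨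
    b + (a / N) * N                   ∎
    where open ≡-Reasoning

  +-cancelʳ-≈ : ∀ a b c → a + c ≈ b + c → a ≈ b
  +-cancelʳ-≈ a b c p =
    ≈-trans (≈-sym (+-multiple-≈ a k)) (≈-trans (≡⇒≈ shifted) (+-multiple-≈ b l))
    where
    k = (b + c) / N
    l = (a + c) / N
    swap : ∀ x y z → x + y + z ≡ x + z + y
    swap x y z = trans (ℕP.+-assoc x y z) (trans (cong (x +_) (ℕP.+-comm y z)) (sym (ℕP.+-assoc x z y)))
    shifted : a + k * N ≡ b + l * N
    shifted = ℕP.+-cancelʳ-≡ c (a + k * N) (b + l * N)
      (trans (swap a (k * N) c) (trans (≈⇒quotients p) (sym (swap b (l * N) c))))

  ∣-resp-≈ : ∀ {a b d} → a ≈ b → d ∣ N → d ∣ b → d ∣ a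
  ∣-resp-≈ (mk p) d∣N d∣b = ∣n∣m%n⇒∣m d∣N (subst (_ ∣_) (sym p) (%-presˡ-∣ d∣b d∣N))

  ≈-+⇒∣ : ∀ a B → a ≈ a + B → N ∣ B
  ≈-+⇒∣ a B p = ∣m+n∣m⇒∣n (subst (N ∣_) shifted (n∣m*n ((a + B) / N))) (n∣m*n (a / N))
    where
    shifted : (a + B) / N * N ≡ a / N * N + B
    shifted = ℕP.+-cancelˡ-≡ a _ _
      (trans (≈⇒quotients p) (trans (ℕP.+-assoc a B _) (cong (a +_) (ℕP.+-comm B _))))

  ≈⇒mod-≡ : ∀ {a b} → a ≈ b → a mod N ≡ b mod N
  ≈⇒mod-≡ (mk p) = FinP.toℕ-injective (trans (FinP.toℕ-fromℕ< _) (trans p (sym (FinP.toℕ-fromℕ< _))))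

  mod-≡⇒≈ : ∀ {a b} → a mod N ≡ b mod N → a ≈ b
  mod-≡⇒≈ p = mk (trans (sym (FinP.toℕ-fromℕ< _)) (trans (cong toℕ p) (FinP.toℕ-fromℕ< _)))

  toℕ-mod : ∀ a → toℕ (a mod N) ≡ a % N
  toℕ-mod a = FinP.toℕ-fromℕ< _

-- Conjugation and commutation in SD_8n

module Semidihedral (h : ℕ) where

  open import Data.Nat using (_+_; _*_)
  open import Data.Nat.DivMod using (_mod_)
  open import Data.Nat.Divisibility
  open import Data.Nat.Tactic.RingSolver using (solve-∀)

  n : ℕ
  n = suc (2 * h)

  N : ℕ
  N = 4 * n

  open ModularArithmetic N
  open import Relation.Binary.Reasoning.Setoid ≈-setoid

  infixl 7 _·_
  _·_ : SD n → SD n → SD n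
  _·_ = SD-mul n

  twist : ℕ
  twist = 2 * n ∸ 1

  -- twist does not reduce to 4h + 1, so identities involving it are proved for a variable c
  -- and instantiated along twist≡.
  twist≡ : twist ≡ suc (4 * h)
  twist≡ = cong (_∸ 1) (double h)
    where
    double : ∀ h → 2 * suc (2 * h) ≡ suc (suc (4 * h))
    double = solve-∀

  n∣N : n ∣ N
  n∣N = n∣m*n 4

  commuting⇒adjacent : ∀ {x y} → x ≢ y → x · y ≡ y · x → CSComAdj n x y
  commuting⇒adjacent {x} {y} x≢y xy≡yx = x≢y , x , y , (x , refl) , (y , refl) , xy≡yx

  rotations-commute : ∀ (i k : Fin N) → (i , zero) · (k , zero) ≡ (k , zero) · (i , zero)
  rotations-commute i k = cong₂ _,_ (cong (_mod N) (ℕP.+-comm (toℕ i) (toℕ k))) refl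

  rotation-central : ∀ (i : Fin N) → n ∣ toℕ i → ∀ y → (i , zero) · y ≡ y · (i , zero)
  rotation-central i n∣i (k , zero) = rotations-commute i k
  rotation-central i (divides q i≡qn) (k , suc zero) = cong₂ _,_ (≈⇒mod-≡ (≈-sym (begin
    toℕ k + twist * toℕ i           ≡⟨ twisted twist twist≡ ⟩
    toℕ i + toℕ k + h * q * N       ≈⟨ +-multiple-≈ (toℕ i + toℕ k) (h * q) ⟩
    toℕ i + toℕ k                   ∎))) refl
    where
    identity : ∀ h q K → K + suc (4 * h) * (q * suc (2 * h)) ≡ q * suc (2 * h) + K + h * q * (4 * suc (2 * h))
    identity = solve-∀
    twisted : ∀ t → t ≡ suc (4 * h) → toℕ k + t * toℕ i ≡ toℕ i + toℕ k + h * q * N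
    twisted t refl rewrite i≡qn = identity h q (toℕ k)

  -- The conjugate y′ = a^t y a^(-t) of y = a^L b is a^Y b with Y ≡ L + 2t (mod n); it commutes with
  -- a^K b once Y ≡ K (mod n). Modulo n = 2h + 1, h + 1 inverts 2 and 2h ≡ −1, so t = (h + 1)(K + 2hL).
  reflection-conjugate-commutes : ∀ (k l : Fin N) →
    ∃[ y′ ] (InConjClass n (l , suc zero) y′ × (k , suc zero) · y′ ≡ y′ · (k , suc zero))
  reflection-conjugate-commutes k l =
    (Y mod N , suc zero) , ((t mod N , zero) , cong₂ _,_ (≈⇒mod-≡ conjugates) refl) , cong₂ _,_ (≈⇒mod-≡ commutes) refl
    where
    K = toℕ k
    L = toℕ l
    t = (h + 1) * (K + 2 * h * L)
    Y = L + (4 * h + 4) * t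
    conjugateIdentity : ∀ h t L → L + (4 * h + 4) * t + suc (4 * h) * t ≡ t + L + t * (4 * suc (2 * h))
    conjugateIdentity = solve-∀
    conjugateIdentityAt : ∀ c → c ≡ suc (4 * h) → Y + c * t ≡ t + L + t * N
    conjugateIdentityAt c refl = conjugateIdentity h t L
    conjugates : toℕ (t mod N) + L ≈ toℕ (Y mod N) + twist * toℕ (t mod N)
    conjugates rewrite toℕ-mod t | toℕ-mod Y = begin
      t % N + L                   ≈⟨ +-≈ (%-≈ t) ≈-refl ⟩
      t + L                       ≈⟨ +-multiple-≈ (t + L) t ⟨
      t + L + t * N               ≡⟨ conjugateIdentityAt twist twist≡ ⟨
      Y + twist * t               ≈⟨ +-≈ (%-≈ Y) (*-≈ twist (%-≈ t)) ⟨
      Y % N + twist * (t % N)     ∎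
    S = L + (n + 2) * (K + 2 * h * L)
    commuteIdentity : ∀ h K L → K + suc (4 * h) * (L + (4 * h + 4) * ((h + 1) * (K + 2 * h * L)))
                  ≡ L + (4 * h + 4) * ((h + 1) * (K + 2 * h * L)) + suc (4 * h) * K
                    + h * (L + (suc (2 * h) + 2) * (K + 2 * h * L)) * (4 * suc (2 * h))
    commuteIdentity = solve-∀
    commuteIdentityAt : ∀ c → c ≡ suc (4 * h) → K + c * Y ≡ Y + c * K + h * S * N
    commuteIdentityAt c refl = commuteIdentity h K L
    commutes : K + twist * toℕ (Y mod N) ≈ toℕ (Y mod N) + twist * K
    commutes rewrite toℕ-mod Y = begin
      K + twist * (Y % N)         ≈⟨ +-≈ (≈-refl {K}) (*-≈ twist (%-≈ Y)) ⟩
      K + twist * Y               ≡⟨ commuteIdentityAt twist twist≡ ⟩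
      Y + twist * K + h * S * N   ≈⟨ +-multiple-≈ (Y + twist * K) (h * S) ⟩
      Y + twist * K               ≈⟨ +-≈ (%-≈ Y) (≈-refl {twist * K}) ⟨
      Y % N + twist * K           ∎

  CSComAdj-sym : ∀ {x y} → CSComAdj n x y → CSComAdj n y x
  CSComAdj-sym (x≢y , x′ , y′ , x∼x′ , y∼y′ , commute) = x≢y ∘ sym , y′ , x′ , y∼y′ , x∼x′ , sym commute

  conjugate-rotation : ∀ (i i′ : Fin N) (j′ : Fin 2) → InConjClass n (i , zero) (i′ , j′) →
    j′ ≡ zero × (n ∣ toℕ i′ → n ∣ toℕ i)
  conjugate-rotation i i′ zero ((s , zero) , eq) =
    refl , ∣-resp-≈ (+-cancelʳ-≈ (toℕ i) (toℕ i′) (toℕ s)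
                      (≈-trans (≡⇒≈ (ℕP.+-comm (toℕ i) (toℕ s))) (mod-≡⇒≈ (cong proj₁ eq)))) n∣N
  conjugate-rotation i i′ zero ((s , suc zero) , eq) =
    refl , λ n∣i′ → ∣m+n∣m⇒∣n (subst (n ∣_) (doubleAt twist twist≡) (n∣m*n (2 * toℕ i)))
                      (∣-resp-≈ (+-cancelʳ-≈ (twist * toℕ i) (toℕ i′) (toℕ s)
                                   (≈-trans (≡⇒≈ (ℕP.+-comm (twist * toℕ i) (toℕ s))) (mod-≡⇒≈ (cong proj₁ eq))))
                                n∣N n∣i′)
    where
    double : ∀ h I → 2 * I * suc (2 * h) ≡ suc (4 * h) * I + I
    double = solve-∀
    doubleAt : ∀ c → c ≡ suc (4 * h) → 2 * toℕ i * n ≡ c * toℕ i + toℕ i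
    doubleAt c refl = double h (toℕ i)
  conjugate-rotation i i′ (suc zero) ((s , zero) , ())
  conjugate-rotation i i′ (suc zero) ((s , suc zero) , ())

  conjugate-reflection : ∀ (l l′ : Fin N) (j′ : Fin 2) → InConjClass n (l , suc zero) (l′ , j′) → j′ ≡ suc zero
  conjugate-reflection l l′ zero ((s , zero) , ())
  conjugate-reflection l l′ zero ((s , suc zero) , ())
  conjugate-reflection l l′ (suc zero) _ = refl

  commutesWithReflection⇒n∣ : ∀ (i l : Fin N) → (i , zero) · (l , suc zero) ≡ (l , suc zero) · (i , zero) → n ∣ toℕ i
  commutesWithReflection⇒n∣ i l eq = ∣m+n∣m⇒∣n (subst (n ∣_) (split h I) (n∣m*n I)) n∣2hI
    where
    I = toℕ i
    L = toℕ l
    shift : ∀ h I L → L + suc (4 * h) * I ≡ I + L + 4 * (h * I)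
    shift = solve-∀
    shiftAt : ∀ c → c ≡ suc (4 * h) → L + c * I ≡ I + L + 4 * (h * I)
    shiftAt c refl = shift h I L
    N∣4hI : N ∣ 4 * (h * I)
    N∣4hI = ≈-+⇒∣ (I + L) (4 * (h * I)) (≈-trans (mod-≡⇒≈ (cong proj₁ eq)) (≡⇒≈ (shiftAt twist twist≡)))
    n∣2hI : n ∣ 2 * h * I
    n∣2hI = subst (n ∣_) (reorder h I) (∣m⇒∣m*n {m = h * I} 2 (*-cancelˡ-∣ 4 N∣4hI))
      where
      reorder : ∀ h I → h * I * 2 ≡ 2 * h * I
      reorder = solve-∀
    split : ∀ h I → I * suc (2 * h) ≡ 2 * h * I + I
    split = solve-∀

  kind : SD n → Kind
  kind (i , zero) with n ∣? toℕ i
  ... | yes _ = central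
  ... | no _ = rotation
  kind (i , suc zero) = reflection

  kind-central : ∀ (i : Fin N) → n ∣ toℕ i → kind (i , zero) ≡ central
  kind-central i n∣i with n ∣? toℕ i
  ... | yes _ = refl
  ... | no n∤i = ⊥-elim (n∤i n∣i)

  kind-rotation : ∀ (i : Fin N) → ¬ n ∣ toℕ i → kind (i , zero) ≡ rotation
  kind-rotation i n∤i with n ∣? toℕ i
  ... | yes n∣i = ⊥-elim (n∤i n∣i)
  ... | no _ = refl

  rotation-reflection-¬adjacent : ∀ x y → kind x ≡ rotation → kind y ≡ reflection → ¬ CSComAdj n x y
  rotation-reflection-¬adjacent (i , zero) y kx ky adj with n ∣? toℕ i
  rotation-reflection-¬adjacent (i , zero) y () ky adj | yes _
  rotation-reflection-¬adjacent (i , zero) (l , zero) kx ky adj | no _ with n ∣? toℕ l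
  rotation-reflection-¬adjacent (i , zero) (l , zero) kx () adj | no _ | yes _
  rotation-reflection-¬adjacent (i , zero) (l , zero) kx () adj | no _ | no _
  rotation-reflection-¬adjacent (i , zero) (l , suc zero) kx ky (_ , (i′ , j′) , (l′ , j″) , x∼x′ , y∼y′ , commute)
    | no n∤i with conjugate-rotation i i′ j′ x∼x′ | conjugate-reflection l l′ j″ y∼y′
  ... | refl , n∣i′⇒n∣i | refl = n∤i (n∣i′⇒n∣i (commutesWithReflection⇒n∣ i′ l′ commute))
  rotation-reflection-¬adjacent (i , suc zero) y () ky adj

  unlinked⇒¬adjacent : ∀ x y → Unlinked (kind x) (kind y) → ¬ CSComAdj n x y
  unlinked⇒¬adjacent x y u with Unlinked-cases u
  ... | inj₁ (kx , ky) = rotation-reflection-¬adjacent x y kx ky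
  ... | inj₂ (kx , ky) = rotation-reflection-¬adjacent y x ky kx ∘ CSComAdj-sym

  ¬unlinked⇒adjacent : ∀ x y → x ≢ y → ¬ Unlinked (kind x) (kind y) → CSComAdj n x y
  ¬unlinked⇒adjacent (i , zero) (k , zero) x≢y _ = commuting⇒adjacent x≢y (rotations-commute i k)
  ¬unlinked⇒adjacent (i , zero) (l , suc zero) x≢y ¬u with n ∣? toℕ i
  ... | yes n∣i = commuting⇒adjacent x≢y (rotation-central i n∣i (l , suc zero))
  ... | no _ = ⊥-elim (¬u rotation-reflection)
  ¬unlinked⇒adjacent (l , suc zero) (i , zero) x≢y ¬u with n ∣? toℕ i
  ... | yes n∣i = commuting⇒adjacent x≢y (sym (rotation-central i n∣i (l , suc zero)))
  ... | no _ = ⊥-elim (¬u reflection-rotation)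
  ¬unlinked⇒adjacent (k , suc zero) (l , suc zero) x≢y _ with reflection-conjugate-commutes k l
  ... | y′ , y∼y′ , commute = x≢y , (k , suc zero) , y′ , ((k , suc zero) , refl) , y∼y′ , commute

-- Sums and determinants

open import Data.Integer using (ℤ; +_; -_; _+_; _-_; _*_; _^_)
import Data.Integer.Properties as ℤP
open import Data.Integer.Tactic.RingSolver using (solve-∀)
open import Algebra.Properties.CommutativeSemigroup ℤP.+-commutativeSemigroup using (interchange; x∙yz≈y∙xz)
open import Algebra.Properties.AbelianGroup ℤP.+-0-abelianGroup using () renaming (inverseʳ-unique to +-inverseʳ-unique)
open import Relation.Nullary.Decidable using (⌊_⌋)
open import Data.Bool using (if_then_else_)
open import Relation.Binary.Definitions using (tri<; tri≈; tri>)

cong₃ : ∀ {A B C D : Set} (f : A → B → C → D) {a a′ b b′ c c′} →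
  a ≡ a′ → b ≡ b′ → c ≡ c′ → f a b c ≡ f a′ b′ c′
cong₃ f refl refl refl = refl

Σℤ-cong : ∀ {k} {f g : Fin k → ℤ} → (∀ i → f i ≡ g i) → Σℤ f ≡ Σℤ g
Σℤ-cong {zero} f≗g = refl
Σℤ-cong {suc k} f≗g = cong₂ _+_ (f≗g zero) (Σℤ-cong (f≗g ∘ suc))

Σℤ-+ : ∀ {k} (f g : Fin k → ℤ) → Σℤ (λ i → f i + g i) ≡ Σℤ f + Σℤ g
Σℤ-+ {zero} f g = refl
Σℤ-+ {suc k} f g = trans (cong (_+_ (f zero + g zero)) (Σℤ-+ (f ∘ suc) (g ∘ suc)))
                         (interchange (f zero) (g zero) (Σℤ (f ∘ suc)) (Σℤ (g ∘ suc)))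

Σℤ-*ˡ : ∀ {k} (a : ℤ) (f : Fin k → ℤ) → Σℤ (λ i → a * f i) ≡ a * Σℤ f
Σℤ-*ˡ {zero} a f = sym (ℤP.*-zeroʳ a)
Σℤ-*ˡ {suc k} a f = trans (cong (_+_ (a * f zero)) (Σℤ-*ˡ a (f ∘ suc)))
                          (sym (ℤP.*-distribˡ-+ a (f zero) (Σℤ (f ∘ suc))))

Σℤ-linear : ∀ {k} (a b : ℤ) (f g : Fin k → ℤ) →
  Σℤ (λ i → a * f i + b * g i) ≡ a * Σℤ f + b * Σℤ g
Σℤ-linear a b f g = trans (Σℤ-+ (λ i → a * f i) (λ i → b * g i)) (cong₂ _+_ (Σℤ-*ˡ a f) (Σℤ-*ˡ b g))

Σℤ-zero : ∀ {k} (f : Fin k → ℤ) → (∀ i → f i ≡ + 0) → Σℤ f ≡ + 0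
Σℤ-zero {zero} f f≗0 = refl
Σℤ-zero {suc k} f f≗0 = cong₂ _+_ (f≗0 zero) (Σℤ-zero (f ∘ suc) (f≗0 ∘ suc))

Σℤ-const : ∀ k a → Σℤ {k} (λ _ → a) ≡ + k * a
Σℤ-const zero a = sym (ℤP.*-zeroˡ a)
Σℤ-const (suc k) a = trans (cong (_+_ a) (Σℤ-const k a)) (sym (ℤP.suc-* (+ k) a))

Σℤ-swap : ∀ {k l} (f : Fin k → Fin l → ℤ) →
  Σℤ (λ i → Σℤ (λ j → f i j)) ≡ Σℤ (λ j → Σℤ (λ i → f i j))
Σℤ-swap {zero} {l} f = sym (Σℤ-zero {l} _ (λ _ → refl))
Σℤ-swap {suc k} f = trans (cong (_+_ (Σℤ (f zero))) (Σℤ-swap (f ∘ suc))) (sym (Σℤ-+ (f zero) _))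

Σℤ-punchIn : ∀ {k} (f : Fin (suc k) → ℤ) (w : Fin (suc k)) →
  Σℤ f ≡ f w + Σℤ (λ u → f (punchIn w u))
Σℤ-punchIn f zero = refl
Σℤ-punchIn {suc k} f (suc w) = trans (cong (_+_ (f zero)) (Σℤ-punchIn (f ∘ suc) w))
                                     (x∙yz≈y∙xz (f zero) (f (suc w)) _)

Σℤ-single : ∀ {k} (f : Fin k → ℤ) (w : Fin k) → (∀ i → i ≢ w → f i ≡ + 0) → Σℤ f ≡ f w
Σℤ-single {suc k} f w f≗0 =
  trans (Σℤ-punchIn f w)
        (trans (cong (_+_ (f w)) (Σℤ-zero _ (λ u → f≗0 (punchIn w u) (FinP.punchInᵢ≢i w u))))
               (ℤP.+-identityʳ (f w)))

Σℤ-pair : ∀ {k} (f : Fin k → ℤ) (p q : Fin k) → p ≢ q →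
  (∀ i → i ≢ p → i ≢ q → f i ≡ + 0) → Σℤ f ≡ f p + f q
Σℤ-pair {suc k} f p q p≢q f≗0 =
  trans (Σℤ-punchIn f p)
        (cong (_+_ (f p)) (trans (Σℤ-single _ q′ vanish) (cong f (FinP.punchIn-punchOut p≢q))))
  where
  q′ = punchOut p≢q
  vanish : ∀ u → u ≢ q′ → f (punchIn p u) ≡ + 0
  vanish u u≢q′ = f≗0 (punchIn p u) (FinP.punchInᵢ≢i p u)
    (λ eq → u≢q′ (FinP.punchIn-injective p u q′ (trans eq (sym (FinP.punchIn-punchOut p≢q)))))

Σℤ-split : ∀ a k (f : Fin (a ℕ.+ k) → ℤ) → Σℤ f ≡ Σℤ (λ i → f (i ↑ˡ k)) + Σℤ (λ j → f (a ↑ʳ j))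
Σℤ-split zero k f = sym (ℤP.+-identityˡ (Σℤ f))
Σℤ-split (suc a) k f = trans (cong (_+_ (f zero)) (Σℤ-split a k (f ∘ suc))) (sym (ℤP.+-assoc (f zero) _ _))

Σℤ-combine : ∀ a b (f : Fin (a ℕ.* b) → ℤ) → Σℤ f ≡ Σℤ (λ q → Σℤ (λ r → f (combine {a} {b} q r)))
Σℤ-combine zero b f = refl
Σℤ-combine (suc a) b f =
  trans (Σℤ-split b (a ℕ.* b) f) (cong (_+_ (Σℤ (λ i → f (i ↑ˡ (a ℕ.* b))))) (Σℤ-combine a b (λ j → f (b ↑ʳ j))))

Σℤ-remQuot : ∀ a (g : Fin a × Fin 2 → ℤ) →
  Σℤ {a ℕ.* 2} (λ v → g (remQuot {a} 2 v)) ≡ Σℤ (λ i → g (i , zero) + g (i , suc zero))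
Σℤ-remQuot zero g = refl
Σℤ-remQuot (suc a) g =
  trans (sym (ℤP.+-assoc (g (zero , zero)) (g (zero , suc zero)) _))
        (cong (_+_ (g (zero , zero) + g (zero , suc zero))) (Σℤ-remQuot a (λ (i , j) → g (suc i , j))))

Matrix : ℕ → Set
Matrix k = Fin k → Fin k → ℤ

transpose : ∀ {k} → Matrix k → Matrix k
transpose M r c = M c r

minor : ∀ {k} → Matrix (suc k) → Fin (suc k) → Matrix k
minor M j r c = M (suc r) (punchIn j c)

cofactorTerm : ∀ {k} → Matrix (suc k) → Fin (suc k) → ℤ
cofactorTerm M j = sgn (toℕ j) * M zero j * det (minor M j)

det-cong : ∀ {k} {M N : Matrix k} → (∀ r c → M r c ≡ N r c) → det M ≡ det N
det-cong {zero} M≗N = refl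
det-cong {suc k} M≗N =
  Σℤ-cong (λ j → cong₂ (λ a d → sgn (toℕ j) * a * d) (M≗N zero j)
                        (det-cong (λ r c → M≗N (suc r) (punchIn j c))))

det-rowLinear : ∀ {k} (M N P : Matrix k) (r : Fin k) (a b : ℤ) →
  (∀ i c → i ≢ r → M i c ≡ N i c) → (∀ i c → i ≢ r → M i c ≡ P i c) →
  (∀ c → M r c ≡ a * N r c + b * P r c) → det M ≡ a * det N + b * det P
det-rowLinear {suc k} M N P zero a b M≗N M≗P Mr =
  trans (Σℤ-cong termLinear) (Σℤ-linear a b (cofactorTerm N) (cofactorTerm P))
  where
  distrib : ∀ s a b x y d → s * (a * x + b * y) * d ≡ a * (s * x * d) + b * (s * y * d)
  distrib = solve-∀
  termLinear : ∀ j → cofactorTerm M j ≡ a * cofactorTerm N j + b * cofactorTerm P j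
  termLinear j = begin
    s * M zero j * det (minor M j)
      ≡⟨ cong₂ (λ x d → s * x * d) (Mr j) (det-cong (λ i c → M≗N (suc i) _ (λ ()))) ⟩
    s * (a * N zero j + b * P zero j) * det (minor N j)
      ≡⟨ distrib s a b (N zero j) (P zero j) (det (minor N j)) ⟩
    a * cofactorTerm N j + b * (s * P zero j * det (minor N j))
      ≡⟨ cong (λ d → a * cofactorTerm N j + b * (s * P zero j * d))
              (det-cong (λ i c → trans (sym (M≗N (suc i) _ (λ ()))) (M≗P (suc i) _ (λ ())))) ⟩
    a * cofactorTerm N j + b * cofactorTerm P j ∎
    where
    open ≡-Reasoning
    s = sgn (toℕ j)
det-rowLinear {suc k} M N P (suc r) a b M≗N M≗P Mr =
  trans (Σℤ-cong termLinear) (Σℤ-linear a b (cofactorTerm N) (cofactorTerm P))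
  where
  distrib : ∀ s a b x d e → s * x * (a * d + b * e) ≡ a * (s * x * d) + b * (s * x * e)
  distrib = solve-∀
  termLinear : ∀ j → cofactorTerm M j ≡ a * cofactorTerm N j + b * cofactorTerm P j
  termLinear j = begin
    s * M zero j * det (minor M j)
      ≡⟨ cong₂ (λ x d → s * x * d) (M≗N zero j (λ ()))
           (det-rowLinear (minor M j) (minor N j) (minor P j) r a b
             (λ i c i≢r → M≗N (suc i) _ (i≢r ∘ FinP.suc-injective))
             (λ i c i≢r → M≗P (suc i) _ (i≢r ∘ FinP.suc-injective))
             (λ c → Mr _)) ⟩
    s * N zero j * (a * det (minor N j) + b * det (minor P j))
      ≡⟨ distrib s a b (N zero j) (det (minor N j)) (det (minor P j)) ⟩
    a * cofactorTerm N j + b * (s * N zero j * det (minor P j))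
      ≡⟨ cong (λ x → a * cofactorTerm N j + b * (s * x * det (minor P j)))
              (trans (sym (M≗N zero j (λ ()))) (M≗P zero j (λ ()))) ⟩
    a * cofactorTerm N j + b * cofactorTerm P j ∎
    where
    open ≡-Reasoning
    s = sgn (toℕ j)

Consecutive : ∀ {k} → Fin k → Fin k → Set
Consecutive p q = toℕ q ≡ suc (toℕ p)

Consecutive⇒≢ : ∀ {k} {p q : Fin k} → Consecutive p q → p ≢ q
Consecutive⇒≢ consecutive refl = ℕP.1+n≢n (sym consecutive)

punchOut-Consecutive : ∀ {k} {j p q : Fin (suc k)} (j≢p : j ≢ p) (j≢q : j ≢ q) →
  Consecutive p q → Consecutive (punchOut j≢p) (punchOut j≢q)
punchOut-Consecutive {j = zero} {zero} j≢p j≢q consecutive = ⊥-elim (j≢p refl)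
punchOut-Consecutive {j = zero} {suc p} {suc q} j≢p j≢q consecutive = ℕP.suc-injective consecutive
punchOut-Consecutive {suc k} {suc zero} {zero} {suc zero} j≢p j≢q consecutive = ⊥-elim (j≢q refl)
punchOut-Consecutive {suc (suc k)} {suc (suc j)} {zero} {suc zero} j≢p j≢q consecutive = refl
punchOut-Consecutive {suc k} {suc j} {suc p} {suc q} j≢p j≢q consecutive =
  cong suc (punchOut-Consecutive (j≢p ∘ cong suc) (j≢q ∘ cong suc) (ℕP.suc-injective consecutive))

punchIn-Consecutive : ∀ {k} {p q : Fin (suc k)} (c : Fin k) → Consecutive p q →
  punchIn p c ≡ punchIn q c ⊎ (punchIn p c ≡ q × punchIn q c ≡ p)
punchIn-Consecutive {p = zero} {suc zero} zero consecutive = inj₂ (refl , refl)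
punchIn-Consecutive {p = zero} {suc zero} (suc c) consecutive = inj₁ refl
punchIn-Consecutive {p = suc p} {suc q} zero consecutive = inj₁ refl
punchIn-Consecutive {p = suc p} {suc q} (suc c) consecutive
  with punchIn-Consecutive {p = p} {q} c (ℕP.suc-injective consecutive)
... | inj₁ eq = inj₁ (cong suc eq)
... | inj₂ (eq , eq′) = inj₂ (cong suc eq , cong suc eq′)

det-consecutiveEqualColumns : ∀ {k} (M : Matrix k) {p q : Fin k} → Consecutive p q →
  (∀ r → M r p ≡ M r q) → det M ≡ + 0
det-consecutiveEqualColumns {suc zero} M {zero} {zero} () _
det-consecutiveEqualColumns {suc (suc k)} M {p} {q} consecutive Mp≗Mq =
  trans (Σℤ-pair (cofactorTerm M) p q (Consecutive⇒≢ consecutive) (otherTermsVanish det-consecutiveEqualColumns))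
        pairCancels
  where
  otherTermsVanish : (∀ (N : Matrix (suc k)) {p q} → Consecutive p q → (∀ r → N r p ≡ N r q) → det N ≡ + 0) →
    ∀ j → j ≢ p → j ≢ q → cofactorTerm M j ≡ + 0
  otherTermsVanish minorVanishes j j≢p j≢q =
    trans (cong (_*_ (sgn (toℕ j) * M zero j))
                (minorVanishes (minor M j) (punchOut-Consecutive j≢p j≢q consecutive) equalColumns))
          (ℤP.*-zeroʳ (sgn (toℕ j) * M zero j))
    where
    equalColumns : ∀ r → minor M j r (punchOut j≢p) ≡ minor M j r (punchOut j≢q)
    equalColumns r = trans (cong (M (suc r)) (FinP.punchIn-punchOut j≢p))
                    (trans (Mp≗Mq (suc r)) (cong (M (suc r)) (sym (FinP.punchIn-punchOut j≢q))))
  sameMinor : ∀ r c → minor M q r c ≡ minor M p r c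
  sameMinor r c with punchIn-Consecutive c consecutive
  ... | inj₁ eq = cong (M (suc r)) (sym eq)
  ... | inj₂ (eq , eq′) = trans (cong (M (suc r)) eq′) (trans (Mp≗Mq (suc r)) (cong (M (suc r)) (sym eq)))
  cancel : ∀ s x d → s * x * d + (- s) * x * d ≡ + 0
  cancel = solve-∀
  pairCancels : cofactorTerm M p + cofactorTerm M q ≡ + 0
  pairCancels =
    trans (cong (_+_ (cofactorTerm M p))
                (cong₃ (λ s x d → s * x * d) (cong sgn consecutive) (sym (Mp≗Mq zero)) (det-cong sameMinor)))
          (cancel (sgn (toℕ p)) (M zero p) (det (minor M p)))

det-transpose : ∀ {k} (M : Matrix k) → det M ≡ det (transpose M)
det-transpose {zero} M = refl
det-transpose {suc zero} M = refl
det-transpose {suc (suc k)} M =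
  cong₂ _+_ (cong (λ d → + 1 * M zero zero * d) (det-transpose (λ r c → M (suc r) (suc c))))
            (otherTerms det-transpose det-transpose)
  where
  minor₂ : Fin (suc k) → Fin (suc k) → Matrix k
  minor₂ i j r c = M (suc (punchIn i r)) (suc (punchIn j c))
  reassociate : ∀ s t a b d → (- s) * a * (t * b * d) ≡ (- t) * b * (s * a * d)
  reassociate = solve-∀
  otherTerms : (∀ (N : Matrix (suc k)) → det N ≡ det (transpose N)) →
               (∀ (N : Matrix k) → det N ≡ det (transpose N)) →
    Σℤ (λ j → cofactorTerm M (suc j)) ≡ Σℤ (λ i → cofactorTerm (transpose M) (suc i))
  otherTerms transpose₁ transpose₂ = begin
    Σℤ (λ j → cofactorTerm M (suc j))
      ≡⟨ Σℤ-cong (λ j → trans (cong (_*_ (- sgn (toℕ j) * M zero (suc j))) (alongFirstColumn j))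
                              (sym (Σℤ-*ˡ (- sgn (toℕ j) * M zero (suc j)) (term j)))) ⟩
    Σℤ (λ j → Σℤ (λ i → (- sgn (toℕ j)) * M zero (suc j) * term j i))
      ≡⟨ Σℤ-swap (λ j i → (- sgn (toℕ j)) * M zero (suc j) * term j i) ⟩
    Σℤ (λ i → Σℤ (λ j → (- sgn (toℕ j)) * M zero (suc j) * term j i))
      ≡⟨ Σℤ-cong (λ i → Σℤ-cong (λ j → reassociate (sgn (toℕ j)) (sgn (toℕ i))
                                        (M zero (suc j)) (M (suc i) zero) (det (minor₂ i j)))) ⟩
    Σℤ (λ i → Σℤ (λ j → (- sgn (toℕ i)) * M (suc i) zero * term′ i j))
      ≡⟨ Σℤ-cong (λ i → trans (Σℤ-*ˡ (- sgn (toℕ i) * M (suc i) zero) (term′ i))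
                              (cong (_*_ (- sgn (toℕ i) * M (suc i) zero)) (sym (alongFirstRow i)))) ⟩
    Σℤ (λ i → cofactorTerm (transpose M) (suc i)) ∎
    where
    open ≡-Reasoning
    term : Fin (suc k) → Fin (suc k) → ℤ
    term j i = sgn (toℕ i) * M (suc i) zero * det (minor₂ i j)
    term′ : Fin (suc k) → Fin (suc k) → ℤ
    term′ i j = sgn (toℕ j) * M zero (suc j) * det (minor₂ i j)
    alongFirstColumn : ∀ j → det (minor M (suc j)) ≡ Σℤ (term j)
    alongFirstColumn j = trans (transpose₁ (minor M (suc j)))
      (Σℤ-cong (λ i → cong (_*_ (sgn (toℕ i) * M (suc i) zero)) (sym (transpose₂ (minor₂ i j)))))
    alongFirstRow : ∀ i → det (minor (transpose M) (suc i)) ≡ Σℤ (term′ i)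
    alongFirstRow i = transpose₁ (minor (transpose M) (suc i))

updateRow : ∀ {k} → Fin k → (Fin k → ℤ) → Matrix k → Matrix k
updateRow p u M i = if ⌊ i ≟ p ⌋ then u else M i

updateRow-≡ : ∀ {k} (p : Fin k) u M c → updateRow p u M p c ≡ u c
updateRow-≡ p u M c with p ≟ p
... | yes _ = refl
... | no p≢p = ⊥-elim (p≢p refl)

updateRow-≢ : ∀ {k} (p : Fin k) u M {i} c → i ≢ p → updateRow p u M i c ≡ M i c
updateRow-≢ p u M {i} c i≢p with i ≟ p
... | yes i≡p = ⊥-elim (i≢p i≡p)
... | no _ = refl

updateRow-comm : ∀ {k} {p q : Fin k} u v M → p ≢ q → ∀ i c →
  updateRow p u (updateRow q v M) i c ≡ updateRow q v (updateRow p u M) i c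
updateRow-comm {p = p} {q} u v M p≢q i c with i ≟ p | i ≟ q
... | yes refl | yes refl = ⊥-elim (p≢q refl)
... | yes refl | no _ = refl
... | no _ | yes refl = refl
... | no _ | no _ = refl

det-consecutiveEqualRows : ∀ {k} (M : Matrix k) {p q : Fin k} → Consecutive p q →
  (∀ c → M p c ≡ M q c) → det M ≡ + 0
det-consecutiveEqualRows M consecutive Mp≗Mq =
  trans (det-transpose M) (det-consecutiveEqualColumns (transpose M) consecutive Mp≗Mq)

det-updateRow-+ : ∀ {k} (p : Fin k) (u v : Fin k → ℤ) (M : Matrix k) →
  det (updateRow p (λ c → u c + v c) M) ≡ det (updateRow p u M) + det (updateRow p v M)
det-updateRow-+ p u v M =
  trans (det-rowLinear (updateRow p (λ c → u c + v c) M) (updateRow p u M) (updateRow p v M) p (+ 1) (+ 1)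
          (λ i c i≢p → trans (updateRow-≢ p _ M c i≢p) (sym (updateRow-≢ p u M c i≢p)))
          (λ i c i≢p → trans (updateRow-≢ p _ M c i≢p) (sym (updateRow-≢ p v M c i≢p)))
          (λ c → trans (updateRow-≡ p _ M c)
                  (sym (cong₂ _+_ (trans (ℤP.*-identityˡ (updateRow p u M p c)) (updateRow-≡ p u M c))
                                  (trans (ℤP.*-identityˡ (updateRow p v M p c)) (updateRow-≡ p v M c))))))
        (cong₂ _+_ (ℤP.*-identityˡ (det (updateRow p u M))) (ℤP.*-identityˡ (det (updateRow p v M))))

swapRows : ∀ {k} → Fin k → Fin k → Matrix k → Matrix k
swapRows p q M = updateRow p (M q) (updateRow q (M p) M)

det-swapConsecutiveRows : ∀ {k} (M : Matrix k) {p q : Fin k} → Consecutive p q → det (swapRows p q M) ≡ - det M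
det-swapConsecutiveRows M {p} {q} consecutive = +-inverseʳ-unique (det M) (det (swapRows p q M)) (begin
    det M + det (swapRows p q M)
      ≡⟨ cong₂ _+_ (det-cong keepsM) refl ⟨
    D (M p) (M q) + D (M q) (M p)
      ≡⟨ cong₂ _+_ (ℤP.+-identityˡ (D (M p) (M q))) (ℤP.+-identityʳ (D (M q) (M p))) ⟨
    + 0 + D (M p) (M q) + (D (M q) (M p) + + 0)
      ≡⟨ cong₂ (λ a b → a + D (M p) (M q) + (D (M q) (M p) + b)) (diagonal (M p)) (diagonal (M q)) ⟨
    D (M p) (M p) + D (M p) (M q) + (D (M q) (M p) + D (M q) (M q))
      ≡⟨ cong₂ _+_ (additiveʳ (M p)) (additiveʳ (M q)) ⟨
    D (M p) s + D (M q) s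
      ≡⟨ det-updateRow-+ p (M p) (M q) (updateRow q s M) ⟨
    D s s
      ≡⟨ diagonal s ⟩
    + 0 ∎)
  where
  open ≡-Reasoning
  p≢q = Consecutive⇒≢ consecutive
  s : Fin _ → ℤ
  s c = M p c + M q c
  D : (Fin _ → ℤ) → (Fin _ → ℤ) → ℤ
  D u v = det (updateRow p u (updateRow q v M))
  diagonal : ∀ u → D u u ≡ + 0
  diagonal u = det-consecutiveEqualRows (updateRow p u (updateRow q u M)) consecutive
    (λ c → trans (updateRow-≡ p u (updateRow q u M) c)
            (sym (trans (updateRow-≢ p u (updateRow q u M) c (p≢q ∘ sym)) (updateRow-≡ q u M c))))
  commuted : ∀ u v → D u v ≡ det (updateRow q v (updateRow p u M))
  commuted u v = det-cong (updateRow-comm u v M p≢q)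
  additiveʳ : ∀ u → D u s ≡ D u (M p) + D u (M q)
  additiveʳ u = trans (commuted u s)
    (trans (det-updateRow-+ q (M p) (M q) (updateRow p u M))
           (sym (cong₂ _+_ (commuted u (M p)) (commuted u (M q)))))
  keepsM : ∀ i c → updateRow p (M p) (updateRow q (M q) M) i c ≡ M i c
  keepsM i c with i ≟ p | i ≟ q
  ... | yes refl | _ = refl
  ... | no _ | yes refl = refl
  ... | no _ | no _ = refl

det-equalRowsAtDistance : ∀ d {k} (M : Matrix k) {p q : Fin k} → toℕ q ≡ suc (d ℕ.+ toℕ p) →
  (∀ c → M p c ≡ M q c) → det M ≡ + 0
det-equalRowsAtDistance zero M consecutive Mp≗Mq = det-consecutiveEqualRows M consecutive Mp≗Mq
det-equalRowsAtDistance (suc d) {suc k} M {p} {suc q} dist Mp≗Mq =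
  trans (sym (ℤP.neg-involutive (det M)))
        (cong -_ (trans (sym (det-swapConsecutiveRows M consecutive))
                        (det-equalRowsAtDistance d (swapRows q′ (suc q) M) dist′ equalRows)))
  where
  q′ = inject₁ q
  consecutive : Consecutive q′ (suc q)
  consecutive = cong suc (sym (FinP.toℕ-inject₁ q))
  dist′ : toℕ q′ ≡ suc (d ℕ.+ toℕ p)
  dist′ = trans (FinP.toℕ-inject₁ q) (ℕP.suc-injective dist)
  apart : ∀ {e} {x : Fin (suc k)} → toℕ x ≡ suc (e ℕ.+ toℕ p) → p ≢ x
  apart dist refl = ℕP.m≢1+n+m _ dist
  equalRows : ∀ c → swapRows q′ (suc q) M p c ≡ swapRows q′ (suc q) M q′ c
  equalRows c =
    trans (updateRow-≢ q′ (M (suc q)) (updateRow (suc q) (M q′) M) c (apart dist′))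
    (trans (updateRow-≢ (suc q) (M q′) M c (apart dist))
    (trans (Mp≗Mq c) (sym (updateRow-≡ q′ (M (suc q)) (updateRow (suc q) (M q′) M) c))))

det-equalRows : ∀ {k} (M : Matrix k) {p q : Fin k} → p ≢ q → (∀ c → M p c ≡ M q c) → det M ≡ + 0
det-equalRows M {p} {q} p≢q Mp≗Mq with ℕP.<-cmp (toℕ p) (toℕ q)
... | tri< p<q _ _ =
  det-equalRowsAtDistance (toℕ q ℕ.∸ suc (toℕ p)) M (sym (trans (sym (ℕP.+-suc _ (toℕ p))) (ℕP.m∸n+n≡m p<q))) Mp≗Mq
... | tri≈ _ p≡q _ = ⊥-elim (p≢q (FinP.toℕ-injective p≡q))
... | tri> _ _ q<p =
  det-equalRowsAtDistance (toℕ p ℕ.∸ suc (toℕ q)) M (sym (trans (sym (ℕP.+-suc _ (toℕ q))) (ℕP.m∸n+n≡m q<p))) (sym ∘ Mp≗Mq)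

det-addRowMultiple : ∀ {k} (M N : Matrix k) {r w : Fin k} (t : ℤ) → r ≢ w →
  (∀ i c → i ≢ w → N i c ≡ M i c) → (∀ c → N w c ≡ M w c + t * M r c) → det N ≡ det M
det-addRowMultiple M N {r} {w} t r≢w N≗M Nw =
  trans (det-rowLinear N M P w (+ 1) t N≗M
          (λ i c i≢w → trans (N≗M i c i≢w) (sym (updateRow-≢ w (M r) M c i≢w)))
          (λ c → trans (Nw c) (cong₂ _+_ (sym (ℤP.*-identityˡ (M w c))) (cong (_*_ t) (sym (updateRow-≡ w (M r) M c))))))
        (trans (cong (λ d → + 1 * det M + t * d) Pvanishes)
               (trans (cong₂ _+_ (ℤP.*-identityˡ (det M)) (ℤP.*-zeroʳ t)) (ℤP.+-identityʳ (det M))))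
  where
  P = updateRow w (M r) M
  Pvanishes : det P ≡ + 0
  Pvanishes = det-equalRows P (r≢w ∘ sym) (λ c → trans (updateRow-≡ w (M r) M c) (sym (updateRow-≢ w (M r) M c r≢w)))

det-addColumnMultiple : ∀ {k} (M N : Matrix k) {r w : Fin k} (t : ℤ) → r ≢ w →
  (∀ i c → c ≢ w → N i c ≡ M i c) → (∀ i → N i w ≡ M i w + t * M i r) → det N ≡ det M
det-addColumnMultiple M N t r≢w N≗M Nw =
  trans (det-transpose N)
    (trans (det-addRowMultiple (transpose M) (transpose N) t r≢w (λ i c c≢w → N≗M c i c≢w) Nw)
           (sym (det-transpose M)))

moveRowToTop : ∀ {k} → Fin (suc k) → Matrix (suc k) → Matrix (suc k)
moveRowToTop w M zero = M w
moveRowToTop w M (suc r) = M (punchIn w r)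

det-moveRowToTop : ∀ {k} (M : Matrix (suc k)) (w : Fin (suc k)) → det (moveRowToTop w M) ≡ sgn (toℕ w) * det M
det-moveRowToTop M w = byDistance (toℕ w) M w refl
  where
  byDistance : ∀ d {k} (M : Matrix (suc k)) (w : Fin (suc k)) → toℕ w ≡ d →
    det (moveRowToTop w M) ≡ sgn d * det M
  byDistance zero M zero eq = trans (det-cong unchanged) (sym (ℤP.*-identityˡ (det M)))
    where
    unchanged : ∀ r c → moveRowToTop zero M r c ≡ M r c
    unchanged zero c = refl
    unchanged (suc r) c = refl
  byDistance (suc d) {suc k} M (suc w) eq =
    trans (det-cong viaSwap)
    (trans (byDistance d (swapRows w′ (suc w) M) w′ (trans (FinP.toℕ-inject₁ w) (ℕP.suc-injective eq)))
    (trans (cong (_*_ (sgn d)) (det-swapConsecutiveRows M consecutive))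
           (trans (sym (ℤP.neg-distribʳ-* (sgn d) (det M))) (ℤP.neg-distribˡ-* (sgn d) (det M)))))
    where
    w′ = inject₁ w
    consecutive : Consecutive w′ (suc w)
    consecutive = cong suc (sym (FinP.toℕ-inject₁ w))
    viaSwap : ∀ r c → moveRowToTop (suc w) M r c ≡ moveRowToTop w′ (swapRows w′ (suc w) M) r c
    viaSwap zero c = sym (updateRow-≡ w′ (M (suc w)) (updateRow (suc w) (M w′) M) c)
    viaSwap (suc r) c with punchIn-Consecutive r consecutive
    ... | inj₁ eq = sym (trans (cong (λ i → swapRows w′ (suc w) M i c) eq)
                    (trans (updateRow-≢ w′ (M (suc w)) (updateRow (suc w) (M w′) M) c (λ eq′ → FinP.punchInᵢ≢i w′ r (trans eq eq′)))
                           (updateRow-≢ (suc w) (M w′) M c (FinP.punchInᵢ≢i (suc w) r))))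
    ... | inj₂ (eq , eq′) = sym (trans (cong (λ i → swapRows w′ (suc w) M i c) eq)
                    (trans (updateRow-≢ w′ (M (suc w)) (updateRow (suc w) (M w′) M) c (Consecutive⇒≢ consecutive ∘ sym))
                           (trans (updateRow-≡ (suc w) (M w′) M c) (cong (λ i → M i c) (sym eq′)))))

sgn-squared : ∀ d → sgn d * sgn d ≡ + 1
sgn-squared zero = refl
sgn-squared (suc d) = begin
  (- sgn d) * (- sgn d) ≡⟨ ℤP.neg-distribˡ-* (sgn d) (- sgn d) ⟨
  - (sgn d * - sgn d)   ≡⟨ cong -_ (ℤP.neg-distribʳ-* (sgn d) (sgn d)) ⟨
  - - (sgn d * sgn d)   ≡⟨ ℤP.neg-involutive (sgn d * sgn d) ⟩
  sgn d * sgn d         ≡⟨ sgn-squared d ⟩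
  + 1                   ∎
  where open ≡-Reasoning

det-singleEntryRow : ∀ {k} (M : Matrix (suc k)) (w : Fin (suc k)) → (∀ c → c ≢ w → M w c ≡ + 0) →
  det M ≡ M w w * det (λ r c → M (punchIn w r) (punchIn w c))
det-singleEntryRow M w Mw≗0 = begin
  det M                      ≡⟨ ℤP.*-identityˡ (det M) ⟨
  + 1 * det M                ≡⟨ cong (_* det M) (sgn-squared (toℕ w)) ⟨
  s * s * det M              ≡⟨ ℤP.*-assoc s s (det M) ⟩
  s * (s * det M)            ≡⟨ cong (_*_ s) (det-moveRowToTop M w) ⟨
  s * det (moveRowToTop w M) ≡⟨ cong (_*_ s) (Σℤ-single (cofactorTerm (moveRowToTop w M)) w otherTermsVanish) ⟩
  s * (s * M w w * D)        ≡⟨ regroup s (M w w) D ⟩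
  s * s * (M w w * D)        ≡⟨ cong (_* (M w w * D)) (sgn-squared (toℕ w)) ⟩
  + 1 * (M w w * D)          ≡⟨ ℤP.*-identityˡ (M w w * D) ⟩
  M w w * D                  ∎
  where
  open ≡-Reasoning
  s = sgn (toℕ w)
  D = det (λ r c → M (punchIn w r) (punchIn w c))
  regroup : ∀ s x d → s * (s * x * d) ≡ s * s * (x * d)
  regroup = solve-∀
  otherTermsVanish : ∀ j → j ≢ w → cofactorTerm (moveRowToTop w M) j ≡ + 0
  otherTermsVanish j j≢w =
    trans (cong (λ x → sgn (toℕ j) * x * det (minor (moveRowToTop w M) j)) (Mw≗0 j j≢w))
          (trans (cong (_* det (minor (moveRowToTop w M) j)) (ℤP.*-zeroʳ (sgn (toℕ j))))
                 (ℤP.*-zeroˡ (det (minor (moveRowToTop w M) j))))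

δ-refl : ∀ {k} (u : Fin k) → δ u u ≡ + 1
δ-refl u with u ≟ u
... | yes _ = refl
... | no u≢u = ⊥-elim (u≢u refl)

δ-≢ : ∀ {k} {u v : Fin k} → u ≢ v → δ u v ≡ + 0
δ-≢ {u = u} {v} u≢v with u ≟ v
... | yes u≡v = ⊥-elim (u≢v u≡v)
... | no _ = refl

δ-punchIn : ∀ {k} (w : Fin (suc k)) (i j : Fin k) → δ (punchIn w i) (punchIn w j) ≡ δ i j
δ-punchIn w i j with i ≟ j
... | yes refl = δ-refl (punchIn w i)
... | no i≢j = δ-≢ (i≢j ∘ FinP.punchIn-injective w i j)

-- Matrices whose entries depend only on the kinds of their row and column

typedMatrix : ∀ {T : Set} {k} (c : T → ℤ) (b : T → T → ℤ) (τ : Fin k → T) (m : Fin k → ℤ) → Matrix k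
typedMatrix c b τ m u v = c (τ u) * δ u v + b (τ u) (τ v) * m v

mergeWeights : ∀ {k} (w r : Fin (suc k)) → (Fin (suc k) → ℤ) → Fin k → ℤ
mergeWeights w r m u = m (punchIn w u) + δ (punchIn w u) r * m w

-- Subtract row r from row w, then add column w to column r: row w becomes c (τ w) times a unit vector.
det-typedMatrix-merge : ∀ {T : Set} {k} (c : T → ℤ) (b : T → T → ℤ) (τ : Fin (suc k) → T) (m : Fin (suc k) → ℤ)
  {w r : Fin (suc k)} → r ≢ w → τ r ≡ τ w →
  det (typedMatrix c b τ m) ≡ c (τ w) * det (typedMatrix c b (τ ∘ punchIn w) (mergeWeights w r m))
det-typedMatrix-merge {T} {k} c b τ m {w} {r} r≢w τr≡τw = begin
  det M
    ≡⟨ det-addRowMultiple M N₁ (- + 1) r≢w (λ i v i≢w → updateRow-≢ w rowW M v i≢w) (updateRow-≡ w rowW M) ⟨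
  det N₁
    ≡⟨ det-addColumnMultiple N₁ N₂ (+ 1) (r≢w ∘ sym) (λ i v v≢r → updateRow-≢ r columnR (transpose N₁) i v≢r)
                             (updateRow-≡ r columnR (transpose N₁)) ⟨
  det N₂
    ≡⟨ det-singleEntryRow N₂ w N₂-rowW ⟩
  N₂ w w * det (λ i j → N₂ (punchIn w i) (punchIn w j))
    ≡⟨ cong₂ _*_ N₂-ww (det-cong minorIsTyped) ⟩
  c (τ w) * det (typedMatrix c b (τ ∘ punchIn w) (mergeWeights w r m)) ∎
  where
  open ≡-Reasoning
  M = typedMatrix c b τ m
  rowW : Fin (suc k) → ℤ
  rowW v = M w v + (- + 1) * M r v
  N₁ = updateRow w rowW M
  columnR : Fin (suc k) → ℤ
  columnR i = N₁ i r + + 1 * N₁ i w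
  N₂ : Matrix (suc k)
  N₂ = transpose (updateRow r columnR (transpose N₁))
  N₂-r : ∀ i → N₂ i r ≡ columnR i
  N₂-r = updateRow-≡ r columnR (transpose N₁)
  N₂-≢r : ∀ i {v} → v ≢ r → N₂ i v ≡ N₁ i v
  N₂-≢r i v≢r = updateRow-≢ r columnR (transpose N₁) i v≢r
  N₁-rowW : ∀ v → N₁ w v ≡ c (τ w) * (δ w v - δ r v)
  N₁-rowW v = trans (updateRow-≡ w rowW M v)
    (trans (cong (λ t → c (τ w) * δ w v + b (τ w) (τ v) * m v + (- + 1) * (c t * δ r v + b t (τ v) * m v)) τr≡τw)
           (difference (c (τ w)) (δ w v) (δ r v) (b (τ w) (τ v) * m v)))
    where
    difference : ∀ x d e y → x * d + y + (- + 1) * (x * e + y) ≡ x * (d - e)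
    difference = solve-∀
  N₂-ww : N₂ w w ≡ c (τ w)
  N₂-ww = trans (N₂-≢r w (r≢w ∘ sym)) (trans (N₁-rowW w)
            (trans (cong₂ (λ d e → c (τ w) * (d - e)) (δ-refl w) (δ-≢ r≢w)) (ℤP.*-identityʳ (c (τ w)))))
  N₂-wr : N₂ w r ≡ + 0
  N₂-wr = trans (N₂-r w) (trans (cong₂ (λ x y → x + + 1 * y) (N₁-rowW r) (N₁-rowW w))
                                (cancel (c (τ w)) (δ-≢ (r≢w ∘ sym)) (δ-refl r) (δ-refl w) (δ-≢ r≢w)))
    where
    cancel₀ : ∀ x → x * (+ 0 - + 1) + + 1 * (x * (+ 1 - + 0)) ≡ + 0
    cancel₀ = solve-∀
    cancel : ∀ x {a b d e} → a ≡ + 0 → b ≡ + 1 → d ≡ + 1 → e ≡ + 0 → x * (a - b) + + 1 * (x * (d - e)) ≡ + 0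
    cancel x refl refl refl refl = cancel₀ x
  N₂-rowW : ∀ v → v ≢ w → N₂ w v ≡ + 0
  N₂-rowW v v≢w = byCases (v ≟ r)
    where
    byCases : Dec (v ≡ r) → N₂ w v ≡ + 0
    byCases (yes v≡r) = trans (cong (N₂ w) v≡r) N₂-wr
    byCases (no v≢r) =
      trans (N₂-≢r w v≢r) (trans (N₁-rowW v)
            (trans (cong₂ (λ d e → c (τ w) * (d - e)) (δ-≢ (v≢w ∘ sym)) (δ-≢ (v≢r ∘ sym))) (ℤP.*-zeroʳ (c (τ w)))))
  minorIsTyped : ∀ i j → N₂ (punchIn w i) (punchIn w j) ≡ typedMatrix c b (τ ∘ punchIn w) (mergeWeights w r m) i j
  minorIsTyped i j = byCases (punchIn w j ≟ r)
    where
    u = punchIn w i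
    v = punchIn w j
    u≢w : u ≢ w
    u≢w = FinP.punchInᵢ≢i w i
    byCases : Dec (v ≡ r) → N₂ u v ≡ c (τ u) * δ i j + b (τ u) (τ v) * (m v + δ v r * m w)
    absorb₀ : ∀ x d y p q → x * d + y * p + + 1 * (x * + 0 + y * q) ≡ x * d + y * (p + + 1 * q)
    absorb₀ = solve-∀
    absorb : ∀ x d y p q {e f} → e ≡ + 0 → f ≡ + 1 → x * d + y * p + + 1 * (x * e + y * q) ≡ x * d + y * (p + f * q)
    absorb x d y p q refl refl = absorb₀ x d y p q
    merged : N₂ u r ≡ c (τ u) * δ u r + b (τ u) (τ r) * (m r + δ r r * m w)
    merged = begin
      N₂ u r
        ≡⟨ N₂-r u ⟩
      N₁ u r + + 1 * N₁ u w
        ≡⟨ cong₂ (λ x y → x + + 1 * y) (updateRow-≢ w rowW M r u≢w) (updateRow-≢ w rowW M w u≢w) ⟩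
      c (τ u) * δ u r + b (τ u) (τ r) * m r + + 1 * (c (τ u) * δ u w + b (τ u) (τ w) * m w)
        ≡⟨ cong (λ t → c (τ u) * δ u r + b (τ u) (τ r) * m r + + 1 * (c (τ u) * δ u w + b (τ u) t * m w)) τr≡τw ⟨
      c (τ u) * δ u r + b (τ u) (τ r) * m r + + 1 * (c (τ u) * δ u w + b (τ u) (τ r) * m w)
        ≡⟨ absorb (c (τ u)) (δ u r) (b (τ u) (τ r)) (m r) (m w) (δ-≢ u≢w) (δ-refl r) ⟩
      c (τ u) * δ u r + b (τ u) (τ r) * (m r + δ r r * m w) ∎
    byCases (yes v≡r) =
      trans (cong (N₂ u) v≡r)
     (trans merged
     (trans (cong (λ t → c (τ u) * δ u t + b (τ u) (τ t) * (m t + δ t r * m w)) (sym v≡r))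
            (cong (λ d → c (τ u) * d + b (τ u) (τ v) * (m v + δ v r * m w)) (δ-punchIn w i j))))
    byCases (no v≢r) =
      trans (N₂-≢r u v≢r)
     (trans (updateRow-≢ w rowW M v u≢w)
            (cong₂ (λ d e → c (τ u) * d + b (τ u) (τ v) * e) (δ-punchIn w i j)
                   (sym (trans (cong (λ z → m v + z * m w) (δ-≢ v≢r))
                               (trans (cong (_+_ (m v)) (ℤP.*-zeroˡ (m w))) (ℤP.+-identityʳ (m v)))))))

linkage : Kind → Kind → ℤ
linkage T T′ with unlinked? T T′
... | yes _ = + 0
... | no _ = + 1

sameKind : Kind → Kind → ℕ
sameKind central central = 1
sameKind reflection reflection = 1
sameKind rotation rotation = 1
sameKind _ _ = 0

indicator : Kind → Kind → ℤ
indicator T T′ = + sameKind T T′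

kindWeight : ∀ {k} → (Fin k → Kind) → (Fin k → ℤ) → Kind → ℤ
kindWeight τ m T = Σℤ (λ u → indicator (τ u) T * m u)

kindWeight-merge : ∀ {k} (τ : Fin (suc k) → Kind) (m : Fin (suc k) → ℤ) {w r : Fin (suc k)} → r ≢ w → τ r ≡ τ w →
  ∀ T → kindWeight (τ ∘ punchIn w) (mergeWeights w r m) T ≡ kindWeight τ m T
kindWeight-merge {k} τ m {w} {r} r≢w τr≡τw T = begin
  Σℤ (λ u → ι (punchIn w u) * (m (punchIn w u) + δ (punchIn w u) r * m w))
    ≡⟨ Σℤ-cong (λ u → ℤP.*-distribˡ-+ (ι (punchIn w u)) (m (punchIn w u)) (δ (punchIn w u) r * m w)) ⟩
  Σℤ (λ u → ι (punchIn w u) * m (punchIn w u) + moved u)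
    ≡⟨ Σℤ-+ (λ u → ι (punchIn w u) * m (punchIn w u)) moved ⟩
  Σℤ (λ u → ι (punchIn w u) * m (punchIn w u)) + Σℤ moved
    ≡⟨ cong (_+_ (Σℤ (λ u → ι (punchIn w u) * m (punchIn w u)))) movedSum ⟩
  Σℤ (λ u → ι (punchIn w u) * m (punchIn w u)) + ι w * m w
    ≡⟨ ℤP.+-comm _ (ι w * m w) ⟩
  ι w * m w + Σℤ (λ u → ι (punchIn w u) * m (punchIn w u))
    ≡⟨ Σℤ-punchIn (λ u → ι u * m u) w ⟨
  kindWeight τ m T ∎
  where
  open ≡-Reasoning
  ι : Fin (suc k) → ℤ
  ι u = indicator (τ u) T
  moved : Fin k → ℤ
  moved u = ι (punchIn w u) * (δ (punchIn w u) r * m w)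
  r′ = punchOut (r≢w ∘ sym)
  r′↦r : punchIn w r′ ≡ r
  r′↦r = FinP.punchIn-punchOut (r≢w ∘ sym)
  movedSum : Σℤ moved ≡ ι w * m w
  movedSum = trans (Σℤ-single moved r′ vanish)
    (trans (cong (λ p → ι p * (δ p r * m w)) r′↦r)
    (trans (cong₂ (λ t d → indicator t T * (d * m w)) τr≡τw (δ-refl r))
           (cong (_*_ (ι w)) (ℤP.*-identityˡ (m w)))))
    where
    vanish : ∀ u → u ≢ r′ → moved u ≡ + 0
    vanish u u≢r′ =
      trans (cong (λ d → ι (punchIn w u) * (d * m w))
                  (δ-≢ (λ eq → u≢r′ (FinP.punchIn-injective w u r′ (trans eq (sym r′↦r))))))
            (ℤP.*-zeroʳ (ι (punchIn w u)))

Σℤ-δ : ∀ {k} (f : Fin k → ℤ) (v : Fin k) → Σℤ (λ u → δ u v * f u) ≡ f v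
Σℤ-δ f v = trans (Σℤ-single (λ u → δ u v * f u) v (λ u u≢v → trans (cong (_* f u) (δ-≢ u≢v)) (ℤP.*-zeroˡ (f u))))
                 (trans (cong (_* f v) (δ-refl v)) (ℤP.*-identityˡ (f v)))

Πℤ : ∀ {k} → (Fin k → ℤ) → ℤ
Πℤ {zero} f = + 1
Πℤ {suc k} f = f zero * Πℤ (f ∘ suc)

representative : Fin 3 → Kind
representative zero = central
representative (suc zero) = reflection
representative (suc (suc zero)) = rotation

representativeIndex : Kind → Fin 3
representativeIndex central = zero
representativeIndex reflection = suc zero
representativeIndex rotation = suc (suc zero)

representative-index : ∀ T → representative (representativeIndex T) ≡ T
representative-index central = refl
representative-index reflection = refl
representative-index rotation = refl

indicator-representative : ∀ u v → indicator (representative u) (representative v) ≡ δ u v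
indicator-representative zero zero = refl
indicator-representative zero (suc zero) = refl
indicator-representative zero (suc (suc zero)) = refl
indicator-representative (suc zero) zero = refl
indicator-representative (suc zero) (suc zero) = refl
indicator-representative (suc zero) (suc (suc zero)) = refl
indicator-representative (suc (suc zero)) zero = refl
indicator-representative (suc (suc zero)) (suc zero) = refl
indicator-representative (suc (suc zero)) (suc (suc zero)) = refl

abstract
  reducedDet : (c : Kind → ℤ) (b : Kind → Kind → ℤ) → (Kind → ℤ) → ℤ
  reducedDet c b W = det (typedMatrix c b representative (W ∘ representative))

  reducedDet-unfold : ∀ c b W → reducedDet c b W ≡ det (typedMatrix c b representative (W ∘ representative))
  reducedDet-unfold c b W = refl

representativeIndex≢3 : ∀ {k} T → representativeIndex T ↑ˡ suc k ≢ 3 ↑ʳ zero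
representativeIndex≢3 central ()
representativeIndex≢3 reflection ()
representativeIndex≢3 rotation ()

reducedDet-cong : ∀ c b {W W′ : Kind → ℤ} → (∀ T → W T ≡ W′ T) → reducedDet c b W ≡ reducedDet c b W′
reducedDet-cong c b {W} {W′} W≗W′ =
  trans (reducedDet-unfold c b W)
 (trans (det-cong (λ u v → cong (_+_ (c (representative u) * δ u v))
                                (cong (_*_ (b (representative u) (representative v))) (W≗W′ (representative v)))))
        (sym (reducedDet-unfold c b W′)))

det-typedMatrix-representatives : ∀ (c : Kind → ℤ) (b : Kind → Kind → ℤ) (τ : Fin 3 → Kind) (m : Fin 3 → ℤ) →
  (∀ i → τ i ≡ representative i) → det (typedMatrix c b τ m) ≡ reducedDet c b (kindWeight τ m)
det-typedMatrix-representatives c b τ m τ≗rep =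
  trans (det-cong {M = typedMatrix c b τ m} {N = typedMatrix c b representative (kindWeight τ m ∘ representative)} pointwise)
        (sym (reducedDet-unfold c b (kindWeight τ m)))
  where
  weightAt : ∀ v → kindWeight τ m (representative v) ≡ m v
  weightAt v = trans (Σℤ-cong (λ u → cong (_* m u) (trans (cong (λ t → indicator t (representative v)) (τ≗rep u))
                                                      (indicator-representative u v))))
                     (Σℤ-δ m v)
  pointwise : ∀ u v → typedMatrix c b τ m u v ≡ typedMatrix c b representative (kindWeight τ m ∘ representative) u v
  pointwise u v = cong₂ (λ t e → c t * δ u v + e) (τ≗rep u)
                        (cong₂ _*_ (cong₂ b (τ≗rep u) (τ≗rep v)) (sym (weightAt v)))

det-typedMatrix-reduce : ∀ k (c : Kind → ℤ) (b : Kind → Kind → ℤ) (τ : Fin (3 ℕ.+ k) → Kind) (m : Fin (3 ℕ.+ k) → ℤ) →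
  (∀ i → τ (i ↑ˡ k) ≡ representative i) →
  det (typedMatrix c b τ m) ≡ Πℤ (c ∘ τ ∘ (3 ↑ʳ_)) * reducedDet c b (kindWeight τ m)
det-typedMatrix-reduce zero c b τ m τ≗rep =
  trans (det-typedMatrix-representatives c b τ m τ≗rep′) (sym (ℤP.*-identityˡ (reducedDet c b (kindWeight τ m))))
  where
  τ≗rep′ : ∀ i → τ i ≡ representative i
  τ≗rep′ zero = τ≗rep zero
  τ≗rep′ (suc zero) = τ≗rep (suc zero)
  τ≗rep′ (suc (suc zero)) = τ≗rep (suc (suc zero))
det-typedMatrix-reduce (suc k) c b τ m τ≗rep = begin
  det (typedMatrix c b τ m)
    ≡⟨ det-typedMatrix-merge c b τ m r≢w τr≡τw ⟩
  c (τ w) * det (typedMatrix c b (τ ∘ punchIn w) (mergeWeights w r m))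
    ≡⟨ cong (_*_ (c (τ w))) (det-typedMatrix-reduce k c b (τ ∘ punchIn w) (mergeWeights w r m) τ′≗rep) ⟩
  c (τ w) * (Πℤ (c ∘ τ ∘ (3 ↑ʳ_) ∘ suc) * reducedDet c b (kindWeight (τ ∘ punchIn w) (mergeWeights w r m)))
    ≡⟨ cong (λ d → c (τ w) * (Πℤ (c ∘ τ ∘ (3 ↑ʳ_) ∘ suc) * d))
            (reducedDet-cong c b (kindWeight-merge τ m r≢w τr≡τw)) ⟩
  c (τ w) * (Πℤ (c ∘ τ ∘ (3 ↑ʳ_) ∘ suc) * reducedDet c b (kindWeight τ m))
    ≡⟨ ℤP.*-assoc (c (τ w)) (Πℤ (c ∘ τ ∘ (3 ↑ʳ_) ∘ suc)) (reducedDet c b (kindWeight τ m)) ⟨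
  Πℤ (c ∘ τ ∘ (3 ↑ʳ_)) * reducedDet c b (kindWeight τ m) ∎
  where
  open ≡-Reasoning
  w : Fin (3 ℕ.+ suc k)
  w = 3 ↑ʳ zero
  r : Fin (3 ℕ.+ suc k)
  r = representativeIndex (τ w) ↑ˡ suc k
  r≢w : r ≢ w
  r≢w = representativeIndex≢3 (τ w)
  τr≡τw : τ r ≡ τ w
  τr≡τw = trans (τ≗rep (representativeIndex (τ w))) (representative-index (τ w))
  τ′≗rep : ∀ i → τ (punchIn w (i ↑ˡ k)) ≡ representative i
  τ′≗rep zero = τ≗rep zero
  τ′≗rep (suc zero) = τ≗rep (suc zero)
  τ′≗rep (suc (suc zero)) = τ≗rep (suc (suc zero))

count : ∀ {k} → (Fin k → Kind) → Kind → ℕ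
count {zero} σ T = 0
count {suc k} σ T = sameKind (σ zero) T ℕ.+ count (σ ∘ suc) T

Σℤ-indicator : ∀ {k} (σ : Fin k → Kind) T → Σℤ (λ u → indicator (σ u) T) ≡ + count σ T
Σℤ-indicator {zero} σ T = refl
Σℤ-indicator {suc k} σ T =
  trans (cong (_+_ (indicator (σ zero) T)) (Σℤ-indicator (σ ∘ suc) T))
        (sym (ℤP.pos-+ (sameKind (σ zero) T) (count (σ ∘ suc) T)))

kindWeight-ones : ∀ {k} (σ : Fin k → Kind) T → kindWeight σ (λ _ → + 1) T ≡ + count σ T
kindWeight-ones σ T = trans (Σℤ-cong (λ u → ℤP.*-identityʳ (indicator (σ u) T))) (Σℤ-indicator σ T)

byIndicators : (g : Kind → ℤ) (T : Kind) →
  g T ≡ g central * indicator T central + (g reflection * indicator T reflection + g rotation * indicator T rotation)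
byIndicators g central = solve₃ (g central) (g reflection) (g rotation)
  where
  solve₃ : ∀ a b c → a ≡ a * + 1 + (b * + 0 + c * + 0)
  solve₃ = solve-∀
byIndicators g reflection = solve₃ (g central) (g reflection) (g rotation)
  where
  solve₃ : ∀ a b c → b ≡ a * + 0 + (b * + 1 + c * + 0)
  solve₃ = solve-∀
byIndicators g rotation = solve₃ (g central) (g reflection) (g rotation)
  where
  solve₃ : ∀ a b c → c ≡ a * + 0 + (b * + 0 + c * + 1)
  solve₃ = solve-∀

Σℤ-byKind : ∀ {k} (σ : Fin k → Kind) (g : Kind → ℤ) →
  Σℤ (g ∘ σ) ≡ g central * + count σ central + (g reflection * + count σ reflection + g rotation * + count σ rotation)
Σℤ-byKind σ g = begin
  Σℤ (g ∘ σ)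
    ≡⟨ Σℤ-cong (λ u → byIndicators g (σ u)) ⟩
  Σℤ (λ u → g central * ι central u + (g reflection * ι reflection u + g rotation * ι rotation u))
    ≡⟨ Σℤ-+ (λ u → g central * ι central u) (λ u → g reflection * ι reflection u + g rotation * ι rotation u) ⟩
  Σℤ (λ u → g central * ι central u) + Σℤ (λ u → g reflection * ι reflection u + g rotation * ι rotation u)
    ≡⟨ cong (_+_ (Σℤ (λ u → g central * ι central u))) (Σℤ-linear (g reflection) (g rotation) (ι reflection) (ι rotation)) ⟩
  Σℤ (λ u → g central * ι central u) + (g reflection * Σℤ (ι reflection) + g rotation * Σℤ (ι rotation))
    ≡⟨ cong₂ (λ x y → x + (g reflection * Σℤ (ι reflection) + g rotation * y)) (Σℤ-*ˡ (g central) (ι central)) (Σℤ-indicator σ rotation) ⟩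
  g central * Σℤ (ι central) + (g reflection * Σℤ (ι reflection) + g rotation * + count σ rotation)
    ≡⟨ cong₂ (λ x y → g central * x + (g reflection * y + g rotation * + count σ rotation)) (Σℤ-indicator σ central) (Σℤ-indicator σ reflection) ⟩
  g central * + count σ central + (g reflection * + count σ reflection + g rotation * + count σ rotation) ∎
  where
  open ≡-Reasoning
  ι : Kind → Fin _ → ℤ
  ι T u = indicator (σ u) T

Πℤ-byKind : ∀ {k} (σ : Fin k → Kind) (g : Kind → ℤ) →
  Πℤ (g ∘ σ) ≡ g central ^ count σ central * g reflection ^ count σ reflection * g rotation ^ count σ rotation
Πℤ-byKind {zero} σ g = refl
Πℤ-byKind {suc k} σ g with σ zero | Πℤ-byKind (σ ∘ suc) g
... | central | ih = trans (cong (_*_ (g central)) ih) (reassociate (g central) (P central) (P reflection) (P rotation))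
  where
  P : Kind → ℤ
  P T = g T ^ count (σ ∘ suc) T
  reassociate : ∀ a x y z → a * (x * y * z) ≡ a * x * y * z
  reassociate = solve-∀
... | reflection | ih = trans (cong (_*_ (g reflection)) ih) (reassociate (g reflection) (P central) (P reflection) (P rotation))
  where
  P : Kind → ℤ
  P T = g T ^ count (σ ∘ suc) T
  reassociate : ∀ a x y z → a * (x * y * z) ≡ x * (a * y) * z
  reassociate = solve-∀
... | rotation | ih = trans (cong (_*_ (g rotation)) ih) (reassociate (g rotation) (P central) (P reflection) (P rotation))
  where
  P : Kind → ℤ
  P T = g T ^ count (σ ∘ suc) T
  reassociate : ∀ a x y z → a * (x * y * z) ≡ x * y * (a * z)
  reassociate = solve-∀

det₃ : ∀ (M : Matrix 3) → det M ≡
  M 0F 0F * (M 1F 1F * M 2F 2F - M 1F 2F * M 2F 1F) - M 0F 1F * (M 1F 0F * M 2F 2F - M 1F 2F * M 2F 0F) + M 0F 2F * (M 1F 0F * M 2F 1F - M 1F 1F * M 2F 0F)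
det₃ M = expand (M 0F 0F) (M 0F 1F) (M 0F 2F) (M 1F 0F) (M 1F 1F) (M 1F 2F) (M 2F 0F) (M 2F 1F) (M 2F 2F)
  where
  expand : ∀ a b c d e f g h i →
    + 1 * a * (+ 1 * e * (+ 1 * i * + 1 + + 0) + ((- + 1) * f * (+ 1 * h * + 1 + + 0) + + 0))
    + ((- + 1) * b * (+ 1 * d * (+ 1 * i * + 1 + + 0) + ((- + 1) * f * (+ 1 * g * + 1 + + 0) + + 0))
    + (+ 1 * c * (+ 1 * d * (+ 1 * h * + 1 + + 0) + ((- + 1) * e * (+ 1 * g * + 1 + + 0) + + 0)) + + 0))
    ≡ a * (e * i - f * h) - b * (d * i - f * g) + c * (d * h - e * g)
  expand = solve-∀

kindDegree : (Kind → ℤ) → Kind → ℤ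
kindDegree W T = linkage T central * W central + (linkage T reflection * W reflection + linkage T rotation * W rotation)

reducedDet-linkage : ∀ x (W : Kind → ℤ) →
  reducedDet (λ T → x - kindDegree W T) linkage W ≡ x * (x - W central) * (x - (W central + W reflection + W rotation))
reducedDet-linkage x W =
  trans (reducedDet-unfold c linkage W)
        (trans (det₃ (typedMatrix c linkage representative (W ∘ representative)))
               (expand x (W central) (W reflection) (W rotation)))
  where
  c : Kind → ℤ
  c T = x - kindDegree W T
  expand : ∀ x a q p →
    let cZ = x - (+ 1 * a + (+ 1 * q + + 1 * p))
        cQ = x - (+ 1 * a + (+ 1 * q + + 0 * p))
        cP = x - (+ 1 * a + (+ 0 * q + + 1 * p))
    in (cZ * + 1 + + 1 * a) * ((cQ * + 1 + + 1 * q) * (cP * + 1 + + 1 * p) - (cQ * + 0 + + 0 * p) * (cP * + 0 + + 0 * q))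
       - (cZ * + 0 + + 1 * q) * ((cQ * + 0 + + 1 * a) * (cP * + 1 + + 1 * p) - (cQ * + 0 + + 0 * p) * (cP * + 0 + + 1 * a))
       + (cZ * + 0 + + 1 * p) * ((cQ * + 0 + + 1 * a) * (cP * + 0 + + 0 * q) - (cQ * + 1 + + 1 * q) * (cP * + 0 + + 1 * a))
       ≡ x * (x - a) * (x - (a + q + p))
  expand = solve-∀

kindCount : ∀ {k} → (Fin k → Kind) → Kind → ℤ
kindCount τ T = + count τ T

KindAdjacency : ∀ {k} → (Fin k → Kind) → Matrix k → Set
KindAdjacency τ A = ∀ u v → A u v ≡ linkage (τ u) (τ v) - δ u v

Σℤ-KindAdjacency : ∀ {k} (τ : Fin k → Kind) {A : Matrix k} → KindAdjacency τ A →
  ∀ u → Σℤ (A u) ≡ kindDegree (kindCount τ) (τ u) - + 1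
Σℤ-KindAdjacency τ {A} adjacency u = begin
  Σℤ (A u)
    ≡⟨ Σℤ-cong (λ v → trans (adjacency u v) (asCombination (linkage (τ u) (τ v)) (δ u v))) ⟩
  Σℤ (λ v → + 1 * linkage (τ u) (τ v) + (- + 1) * δ u v)
    ≡⟨ Σℤ-linear (+ 1) (- + 1) (linkage (τ u) ∘ τ) (δ u) ⟩
  + 1 * Σℤ (linkage (τ u) ∘ τ) + (- + 1) * Σℤ (δ u)
    ≡⟨ cong₂ (λ s d → + 1 * s + (- + 1) * d) (Σℤ-byKind τ (linkage (τ u))) Σδ ⟩
  + 1 * kindDegree (kindCount τ) (τ u) + (- + 1) * + 1
    ≡⟨ simplify (kindDegree (kindCount τ) (τ u)) ⟩
  kindDegree (kindCount τ) (τ u) - + 1 ∎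
  where
  open ≡-Reasoning
  asCombination : ∀ a b → a - b ≡ + 1 * a + (- + 1) * b
  asCombination = solve-∀
  simplify : ∀ s → + 1 * s + (- + 1) * + 1 ≡ s - + 1
  simplify = solve-∀
  Σδ : Σℤ (δ u) ≡ + 1
  Σδ = trans (Σℤ-single (δ u) u (λ v v≢u → δ-≢ (v≢u ∘ sym))) (δ-refl u)

KindAdjacency-characteristic : ∀ {k} (τ : Fin k → Kind) {A : Matrix k} → KindAdjacency τ A → ∀ x u v →
  x * δ u v - laplacian A u v ≡ typedMatrix (λ T → x - kindDegree (kindCount τ) T) linkage τ (λ _ → + 1) u v
KindAdjacency-characteristic τ adjacency x u v =
  trans (cong₂ (λ s a → x * δ u v - (δ u v * s - a)) (Σℤ-KindAdjacency τ adjacency u) (adjacency u v))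
        (regroup x (δ u v) (kindDegree (kindCount τ) (τ u)) (linkage (τ u) (τ v)))
  where
  regroup : ∀ x d s b → x * d - (d * (s - + 1) - (b - d)) ≡ (x - s) * d + b * + 1
  regroup = solve-∀

count-representatives : ∀ {k} (τ : Fin (3 ℕ.+ k) → Kind) → (∀ i → τ (i ↑ˡ k) ≡ representative i) →
  ∀ T → count τ T ≡ suc (count (τ ∘ (3 ↑ʳ_)) T)
count-representatives τ τ≗rep T =
  trans (cong₃ (λ a b d → sameKind a T ℕ.+ (sameKind b T ℕ.+ (sameKind d T ℕ.+ count (τ ∘ (3 ↑ʳ_)) T)))
               (τ≗rep 0F) (τ≗rep 1F) (τ≗rep 2F))
        (oneOfEach T)
  where
  oneOfEach : ∀ T → sameKind central T ℕ.+ (sameKind reflection T ℕ.+ (sameKind rotation T ℕ.+ count (τ ∘ (3 ↑ʳ_)) T))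
                    ≡ suc (count (τ ∘ (3 ↑ʳ_)) T)
  oneOfEach central = refl
  oneOfEach reflection = refl
  oneOfEach rotation = refl

kindWeights : ℤ → ℤ → ℤ → Kind → ℤ
kindWeights a q p central = a
kindWeights a q p reflection = q
kindWeights a q p rotation = p

-- a, q and p count the central, reflection and rotation vertices.
kindCharPoly : ℕ → ℕ → ℕ → ℤ → ℤ
kindCharPoly a q p x =
  c central ^ (a ∸ 1) * c reflection ^ (q ∸ 1) * c rotation ^ (p ∸ 1) * (x * (x - + a) * (x - (+ a + + q + + p)))
  where
  c : Kind → ℤ
  c T = x - kindDegree (kindWeights (+ a) (+ q) (+ p)) T

-- The size m is kept apart from 3 + k so that, for graphs whose size merely reduces to 3 + k,
-- the two determinants are never compared by unfolding them.
charPolyAt-KindAdjacency : ∀ {m} k → (e : m ≡ 3 ℕ.+ k) (τ : Fin m → Kind) {A : Matrix m} → KindAdjacency τ A →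
  (∀ i → τ (subst Fin (sym e) (i ↑ˡ k)) ≡ representative i) → ∀ x →
  charPolyAt (laplacian A) x ≡ kindCharPoly (count τ central) (count τ reflection) (count τ rotation) x
charPolyAt-KindAdjacency k refl τ {A} adjacency τ≗rep x = begin
  charPolyAt (laplacian A) x
    ≡⟨ det-cong (KindAdjacency-characteristic τ adjacency x) ⟩
  det (typedMatrix c linkage τ (λ _ → + 1))
    ≡⟨ det-typedMatrix-reduce k c linkage τ (λ _ → + 1) τ≗rep ⟩
  Πℤ (c ∘ tail) * reducedDet c linkage (kindWeight τ (λ _ → + 1))
    ≡⟨ cong₂ _*_ (Πℤ-byKind tail c) (trans (reducedDet-cong c linkage (kindWeight-ones τ)) (reducedDet-linkage x W)) ⟩
  c central ^ count tail central * c reflection ^ count tail reflection * c rotation ^ count tail rotation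
    * (x * (x - W central) * (x - (W central + W reflection + W rotation)))
    ≡⟨ cong₃ (λ a q p → c central ^ (a ∸ 1) * c reflection ^ (q ∸ 1) * c rotation ^ (p ∸ 1)
                          * (x * (x - W central) * (x - (W central + W reflection + W rotation))))
             (count-representatives τ τ≗rep central) (count-representatives τ τ≗rep reflection)
             (count-representatives τ τ≗rep rotation) ⟨
  kindCharPoly (count τ central) (count τ reflection) (count τ rotation) x ∎
  where
  open ≡-Reasoning
  W : Kind → ℤ
  W = kindCount τ
  c : Kind → ℤ
  c T = x - kindDegree W T
  tail : Fin k → Kind
  tail = τ ∘ (3 ↑ʳ_)

open import Data.Nat.DivMod using (m≡m%n+[m/n]*n)
open import Data.Nat.Divisibility using (_∣_; m∣m*n; ∣m+n∣m⇒∣n; ∣⇒≤)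

-- The Laplacian of CSCom(SD_8n)

module Laplacian (h′ : ℕ) where

  h : ℕ
  h = suc h′

  open Semidihedral h using (n; kind; kind-central; kind-rotation; unlinked⇒¬adjacent; ¬unlinked⇒adjacent)

  vertexKind : Vtx n → Kind
  vertexKind v = kind (elt n v)

  elt-injective : ∀ {u v} → elt n u ≡ elt n v → u ≡ v
  elt-injective {u} {v} eq = trans (sym (FinP.combine-remQuot {4 ℕ.* n} 2 u))
    (trans (cong (uncurry combine) eq) (FinP.combine-remQuot {4 ℕ.* n} 2 v))

  adjacency-linkage : ∀ {A} → IsAdjMatrix n A → ∀ u v → A u v ≡ linkage (vertexKind u) (vertexKind v) - δ u v
  adjacency-linkage isA u v with isA u v | unlinked? (vertexKind u) (vertexKind v)
  ... | inj₁ (adj , _) | yes unlinked = ⊥-elim (unlinked⇒¬adjacent (elt n u) (elt n v) unlinked adj)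
  ... | inj₁ (adj , A≡1) | no linked =
    trans A≡1 (sym (cong (_-_ (+ 1)) (δ-≢ {u = u} {v} (proj₁ adj ∘ cong (elt n)))))
  ... | inj₂ (_ , A≡0) | yes unlinked =
    trans A≡0 (sym (cong (_-_ (+ 0)) (δ-≢ {u = u} {v} λ { refl → Unlinked-irreflexive unlinked })))
  ... | inj₂ (¬adj , A≡0) | no linked with u ≟ v
  ...   | yes refl = A≡0
  ...   | no u≢v = ⊥-elim (¬adj (¬unlinked⇒adjacent (elt n u) (elt n v) (u≢v ∘ elt-injective) linked))

  n∣combine-zero : ∀ (q : Fin 4) → n ∣ toℕ (combine {4} {n} q zero)
  n∣combine-zero q = subst (n ∣_) (sym (trans (FinP.toℕ-combine q zero) (ℕP.+-identityʳ _))) (m∣m*n (toℕ q))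

  n∤combine-suc : ∀ (q : Fin 4) (r : Fin (2 ℕ.* h)) → ¬ n ∣ toℕ (combine {4} {n} q (suc r))
  n∤combine-suc q r n∣ = ℕP.<⇒≱ (FinP.toℕ<n (suc r))
    (∣⇒≤ (∣m+n∣m⇒∣n (subst (n ∣_) (FinP.toℕ-combine q (suc r)) n∣) (m∣m*n (toℕ q))))

  -- The rotation exponents nq + r (q < 4, r < n) are central exactly when r = 0.
  kindCensus : ∀ T → Σℤ (λ v → indicator (vertexKind v) T)
    ≡ + 4 * (indicator central T + + (2 ℕ.* h) * indicator rotation T) + + (4 ℕ.* n) * indicator reflection T
  kindCensus T = begin
    Σℤ (λ v → indicator (vertexKind v) T)
      ≡⟨ Σℤ-remQuot (4 ℕ.* n) (λ x → indicator (kind x) T) ⟩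
    Σℤ (λ i → ι i + indicator reflection T)
      ≡⟨ Σℤ-+ ι (λ _ → indicator reflection T) ⟩
    Σℤ ι + Σℤ {4 ℕ.* n} (λ _ → indicator reflection T)
      ≡⟨ cong₂ _+_ rotations (Σℤ-const (4 ℕ.* n) (indicator reflection T)) ⟩
    + 4 * (indicator central T + + (2 ℕ.* h) * indicator rotation T) + + (4 ℕ.* n) * indicator reflection T ∎
    where
    open ≡-Reasoning
    ι : Fin (4 ℕ.* n) → ℤ
    ι i = indicator (kind (i , zero)) T
    coset : ∀ q → Σℤ (λ r → ι (combine {4} {n} q r)) ≡ indicator central T + + (2 ℕ.* h) * indicator rotation T
    coset q = cong₂ _+_ (cong (λ K → indicator K T) (kind-central _ (n∣combine-zero q)))
      (trans (Σℤ-cong (λ r → cong (λ K → indicator K T) (kind-rotation _ (n∤combine-suc q r))))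
             (Σℤ-const (2 ℕ.* h) (indicator rotation T)))
    rotations : Σℤ ι ≡ + 4 * (indicator central T + + (2 ℕ.* h) * indicator rotation T)
    rotations = trans (Σℤ-combine 4 n ι) (trans (Σℤ-cong coset) (Σℤ-const 4 _))

  X : ℤ
  X = + (2 ℕ.* h)

  countFromCensus : ∀ T {c} → + 4 * (indicator central T + X * indicator rotation T) + + (4 ℕ.* n) * indicator reflection T ≡ + c →
    count vertexKind T ≡ c
  countFromCensus T census = ℤP.+-injective (trans (sym (Σℤ-indicator vertexKind T)) (trans (kindCensus T) census))

  count-central : count vertexKind central ≡ 4
  count-central = countFromCensus central (evaluate X (+ (4 ℕ.* n)))
    where
    evaluate : ∀ r q → + 4 * (+ 1 + r * + 0) + q * + 0 ≡ + 4
    evaluate = solve-∀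

  count-reflection : count vertexKind reflection ≡ 4 ℕ.* n
  count-reflection = countFromCensus reflection (evaluate X (+ (4 ℕ.* n)))
    where
    evaluate : ∀ r q → + 4 * (+ 0 + r * + 0) + q * + 1 ≡ q
    evaluate = solve-∀

  count-rotation : count vertexKind rotation ≡ 4 ℕ.* (2 ℕ.* h)
  count-rotation = countFromCensus rotation (trans (evaluate X (+ (4 ℕ.* n))) (sym (ℤP.pos-* 4 (2 ℕ.* h))))
    where
    evaluate : ∀ r q → + 4 * (+ 0 + r * + 1) + q * + 0 ≡ + 4 * r
    evaluate = solve-∀

  scaled : ∀ k → + (k ℕ.* n) ≡ + k * (+ 1 + X)
  scaled k = ℤP.pos-* k n

  counts : ∀ (f : ℤ → ℤ → ℤ → ℤ) → f (+ 4) (+ (4 ℕ.* n)) (+ (4 ℕ.* (2 ℕ.* h))) ≡ f (+ 4) (+ 4 * (+ 1 + X)) (+ 4 * X)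
  counts f = cong₂ (f (+ 4)) (scaled 4) (ℤP.pos-* 4 (2 ℕ.* h))

  kindCharPoly-SD : ∀ x → kindCharPoly 4 (4 ℕ.* n) (4 ℕ.* (2 ℕ.* h)) x
      ≡ x * (x - + 4) * (x - + (4 ℕ.* n)) ^ (4 ℕ.* n ∸ 5)
          * (x - + (4 ℕ.* n ℕ.+ 4)) ^ (4 ℕ.* n ∸ 1) * (x - + (8 ℕ.* n)) ^ 4
  kindCharPoly-SD x = begin
    c central ^ 3 * c reflection ^ (4 ℕ.* n ∸ 1) * c rotation ^ (4 ℕ.* (2 ℕ.* h) ∸ 1)
      * (x * (x - + 4) * (x - (+ 4 + + (4 ℕ.* n) + + (4 ℕ.* (2 ℕ.* h)))))
      ≡⟨ cong₃ (λ Z Z′ e → Z ^ 3 * c reflection ^ (4 ℕ.* n ∸ 1) * c rotation ^ e * (x * (x - + 4) * Z′))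
               degree-central (cong (_-_ x) total) (sym (cong (_∸ 5) (ℕP.*-suc 4 (2 ℕ.* h)))) ⟩
    (x - + (8 ℕ.* n)) ^ 3 * c reflection ^ (4 ℕ.* n ∸ 1) * c rotation ^ (4 ℕ.* n ∸ 5) * (x * (x - + 4) * (x - + (8 ℕ.* n)))
      ≡⟨ cong₂ (λ R P → (x - + (8 ℕ.* n)) ^ 3 * R ^ (4 ℕ.* n ∸ 1) * P ^ (4 ℕ.* n ∸ 5) * (x * (x - + 4) * (x - + (8 ℕ.* n))))
               degree-reflection degree-rotation ⟩
    (x - + (8 ℕ.* n)) ^ 3 * (x - + (4 ℕ.* n ℕ.+ 4)) ^ (4 ℕ.* n ∸ 1) * (x - + (4 ℕ.* n)) ^ (4 ℕ.* n ∸ 5)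
      * (x * (x - + 4) * (x - + (8 ℕ.* n)))
      ≡⟨ rearrange x (x - + (8 ℕ.* n)) ((x - + (4 ℕ.* n ℕ.+ 4)) ^ (4 ℕ.* n ∸ 1)) ((x - + (4 ℕ.* n)) ^ (4 ℕ.* n ∸ 5)) ⟩
    x * (x - + 4) * (x - + (4 ℕ.* n)) ^ (4 ℕ.* n ∸ 5)
      * (x - + (4 ℕ.* n ℕ.+ 4)) ^ (4 ℕ.* n ∸ 1) * (x - + (8 ℕ.* n)) ^ 4 ∎
    where
    open ≡-Reasoning
    c : Kind → ℤ
    c T = x - kindDegree (kindWeights (+ 4) (+ (4 ℕ.* n)) (+ (4 ℕ.* (2 ℕ.* h)))) T
    total : + 4 + + (4 ℕ.* n) + + (4 ℕ.* (2 ℕ.* h)) ≡ + (8 ℕ.* n)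
    total = trans (counts (λ a q p → a + q + p)) (trans (identity X) (sym (scaled 8)))
      where
      identity : ∀ X → + 4 + + 4 * (+ 1 + X) + + 4 * X ≡ + 8 * (+ 1 + X)
      identity = solve-∀
    degree-central : c central ≡ x - + (8 ℕ.* n)
    degree-central = cong (_-_ x) (trans (counts (λ a q p → + 1 * a + (+ 1 * q + + 1 * p))) (trans (identity X) (sym (scaled 8))))
      where
      identity : ∀ X → + 1 * + 4 + (+ 1 * (+ 4 * (+ 1 + X)) + + 1 * (+ 4 * X)) ≡ + 8 * (+ 1 + X)
      identity = solve-∀
    degree-reflection : c reflection ≡ x - + (4 ℕ.* n ℕ.+ 4)
    degree-reflection = cong (_-_ x)
      (trans (counts (λ a q p → + 1 * a + (+ 1 * q + + 0 * p)))
             (trans (identity X) (sym (trans (ℤP.pos-+ (4 ℕ.* n) 4) (cong (_+ + 4) (scaled 4))))))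
      where
      identity : ∀ X → + 1 * + 4 + (+ 1 * (+ 4 * (+ 1 + X)) + + 0 * (+ 4 * X)) ≡ + 4 * (+ 1 + X) + + 4
      identity = solve-∀
    degree-rotation : c rotation ≡ x - + (4 ℕ.* n)
    degree-rotation = cong (_-_ x) (trans (counts (λ a q p → + 1 * a + (+ 0 * q + + 1 * p))) (trans (identity X) (sym (scaled 4))))
      where
      identity : ∀ X → + 1 * + 4 + (+ 0 * (+ 4 * (+ 1 + X)) + + 1 * (+ 4 * X)) ≡ + 4 * (+ 1 + X)
      identity = solve-∀
    rearrange : ∀ x z a b → z * (z * (z * + 1)) * a * b * (x * (x - + 4) * z)
                          ≡ x * (x - + 4) * b * a * (z * (z * (z * (z * + 1))))
    rearrange = solve-∀

  -- Stated for any m ≡ n: the caller's odd number is then never unfolded against n inside these large types.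
  charPoly : ∀ {m} → m ≡ n → ∀ {A : Vtx m → Vtx m → ℤ} → IsAdjMatrix m A → ∀ x →
    charPolyAt (laplacian A) x
      ≡ x * (x - + 4) * (x - + (4 ℕ.* m)) ^ (4 ℕ.* m ∸ 5)
          * (x - + (4 ℕ.* m ℕ.+ 4)) ^ (4 ℕ.* m ∸ 1) * (x - + (8 ℕ.* m)) ^ 4
  charPoly refl {A} isA x = begin
    charPolyAt (laplacian A) x
      ≡⟨ charPolyAt-KindAdjacency (4 ℕ.* n ℕ.* 2 ∸ 3) refl vertexKind (adjacency-linkage isA)
           (λ { 0F → refl ; 1F → refl ; 2F → refl }) x ⟩   -- vertices 0, 1, 2 are e, b, a
    kindCharPoly (count vertexKind central) (count vertexKind reflection) (count vertexKind rotation) x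
      ≡⟨ cong₃ (λ a q p → kindCharPoly a q p x) count-central count-reflection count-rotation ⟩
    kindCharPoly 4 (4 ℕ.* n) (4 ℕ.* (2 ℕ.* h)) x
      ≡⟨ kindCharPoly-SD x ⟩
    x * (x - + 4) * (x - + (4 ℕ.* n)) ^ (4 ℕ.* n ∸ 5)
      * (x - + (4 ℕ.* n ℕ.+ 4)) ^ (4 ℕ.* n ∸ 1) * (x - + (8 ℕ.* n)) ^ 4 ∎
    where open ≡-Reasoning

odd-decompose : ∀ {n} → 3 ≤ n → n % 2 ≡ 1 → ∃[ h′ ] n ≡ suc (2 ℕ.* suc h′)
odd-decompose {n} 3≤n odd with n ℕ./ 2 | m≡m%n+[m/n]*n n 2
... | zero | n≡ = contradiction (subst (3 ≤_) (trans n≡ (cong (ℕ._+ 0) odd)) 3≤n) λ { (ℕ.s≤s ()) }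
... | suc q | n≡ = q , trans n≡ (trans (cong (ℕ._+ suc q ℕ.* 2) odd) (cong suc (ℕP.*-comm (suc q) 2)))

mainTheorem18 : (n : ℕ) → 3 ≤ n → n % 2 ≡ 1 →
    (A : Vtx n → Vtx n → ℤ) → IsAdjMatrix n A →
    (x : ℤ) →
    charPolyAt (laplacian A) x
      ≡ x * (x - + 4) * (x - + (4 ℕ.* n)) ^ (4 ℕ.* n ∸ 5)
          * (x - + (4 ℕ.* n ℕ.+ 4)) ^ (4 ℕ.* n ∸ 1) * (x - + (8 ℕ.* n)) ^ 4
mainTheorem18 n 3≤n odd A isA x with odd-decompose 3≤n odd
... | h′ , n≡ = Laplacian.charPoly h′ n≡ isA x
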